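{- Let $X$ be a finite set of points in $\mathbb{R}^d$ and let $r \ge 1$ be an integer. If $|X| \ge (d+1)(r-1)+2$, then the graph $\mathbf{RG}_{\mathrm{Tv}}(X,r)$ is connected.
   Context: An ordered Tverberg $r$-partition of a finite set $Y \subset \mathbb{R}^d$ is an ordered tuple $(Y_1,\ldots,Y_r)$ of pairwise disjoint subsets (possibly empty) with $Y_1 \cup \cdots \cup Y_r = Y$ and $\bigcap_{i=1}^r \mathrm{conv}(Y_i) \neq \emptyset$ (with $\mathrm{conv}(\emptyset)=\emptyset$). The graph $\mathbf{RG}_{\mathrm{Tv}}(X,r)$ has as vertices all ordered Tverberg $r$-partitions of $X$; two of them are adjacent if they differ only in the placement of a single point $x \in X$ among the $r$ classes, and deleting $x$ from either of the two partitions yields an ordered Tverberg $r$-partition of $X \setminus \{x\}$. -}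

module Defs where

open import Algebra.Bundles using (CommutativeRing)
import Algebra.Properties.CommutativeMonoid.Sum as CMSum
open import Data.Fin.Base using (Fin)
open import Data.Fin.Subset using (Subset; _∉_; _∩_; _-_; ⋃; Empty; ⊤)
open import Data.Nat.Base using (ℕ)
open import Data.Product.Base using (∃; _×_; _,_)
open import Data.Vec.Base using (Vec; lookup; map; toList)
open import Data.Vec.Functional using (Vector)
open import Data.Vec.Functional.Relation.Binary.Pointwise using (Pointwise)
open import Function.Definitions using (Injective)
open import Level using (_⊔_; suc)
open import Relation.Binary.Construct.Closure.ReflexiveTransitive using (Star)
import Relation.Binary.Construct.StrictToNonStrict as StrictToNonStrict
open import Relation.Binary.Core using (Rel)
open import Relation.Binary.Definitions using (Symmetric)
open import Relation.Binary.PropositionalEquality using (_≡_; _≢_; refl; sym; ≢-sym)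
open import Relation.Binary.Structures using (IsStrictTotalOrder)
open import Relation.Nullary.Negation.Core using (¬_)
open import Relation.Unary using (Pred)

-- The real numbers, given axiomatically: a Dedekind-complete ordered field is
-- unique up to isomorphism.  The standard library has no type of real numbers.
record CompleteOrderedField c ℓ₁ ℓ₂ : Set (suc (c ⊔ ℓ₁ ⊔ ℓ₂)) where
  infix 4 _<_
  field
    commutativeRing : CommutativeRing c ℓ₁

  open CommutativeRing commutativeRing public

  field
    _<_                : Rel Carrier ℓ₂
    isStrictTotalOrder : IsStrictTotalOrder _≈_ _<_
    0<1                : 0# < 1#
    inverse            : ∀ x → ¬ (x ≈ 0#) → ∃ λ y → x * y ≈ 1#
    +-monoˡ-<          : ∀ {x y} z → x < y → x + z < y + z
    *-pos              : ∀ {x y} → 0# < x → 0# < y → 0# < x * y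

  open StrictToNonStrict _≈_ _<_ public using (_≤_)

  IsUpperBound : ∀ {p} → Pred Carrier p → Pred Carrier (c ⊔ ℓ₁ ⊔ ℓ₂ ⊔ p)
  IsUpperBound S b = ∀ x → S x → x ≤ b

  -- Classically the second component says that no x < s is an upper bound.
  -- In this positive form, completeness together with the trichotomy of _<_
  -- yields excluded middle for types in Set (c ⊔ ℓ₁ ⊔ ℓ₂), so the axioms
  -- describe the classical real line.
  IsSupremum : ∀ {p} → Pred Carrier p → Pred Carrier (c ⊔ ℓ₁ ⊔ ℓ₂ ⊔ p)
  IsSupremum S s = IsUpperBound S s × (∀ x → x < s → ∃ λ y → S y × x < y)

  field
    complete : (S : Pred Carrier (c ⊔ ℓ₁ ⊔ ℓ₂)) →
               ∃ S → ∃ (IsUpperBound S) → ∃ (IsSupremum S)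

-- A simple graph whose vertices are the elements of A satisfying IsVertex.
-- Keeping IsVertex separate identifies vertices that differ only in the proof
-- of IsVertex.
record Graph {a} (A : Set a) v e : Set (a ⊔ suc (v ⊔ e)) where
  field
    IsVertex   : Pred A v
    Adjacent   : Rel A e
    endpoints  : ∀ {x y} → Adjacent x y → IsVertex x × IsVertex y
    adj-sym    : Symmetric Adjacent
    adj-irrefl : ∀ {x} → ¬ Adjacent x x

-- The empty graph does not count as connected.
Connected : ∀ {a v e} {A : Set a} → Graph A v e → Set (a ⊔ v ⊔ e)
Connected G = ∃ IsVertex × (∀ {x y} → IsVertex x → IsVertex y → Star Adjacent x y)
  where open Graph G

module _ {c ℓ₁ ℓ₂} (ℝ : CompleteOrderedField c ℓ₁ ℓ₂) where

  private
    module ℝ = CompleteOrderedField ℝ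
    open CMSum ℝ.+-commutativeMonoid using (sum)

  Point : ℕ → Set c
  Point d = Vector ℝ.Carrier d

  -- A finite set of n points is given by an enumeration without repetitions.
  Distinct : ∀ {d n} → Vector (Point d) n → Set ℓ₁
  Distinct X = Injective _≡_ (Pointwise ℝ._≈_) X

  module _ {d n} (X : Vector (Point d) n) where

    -- p ∈ conv { X j ∣ j ∈ S }.  The weights sum to 1#, so conv ∅ = ∅.
    record _∈conv_ (p : Point d) (S : Subset n) : Set (c ⊔ ℓ₁ ⊔ ℓ₂) where
      field
        weight      : Vector ℝ.Carrier n
        nonneg      : ∀ j → ℝ.0# ℝ.≤ weight j
        supported   : ∀ j → j ∉ S → weight j ℝ.≈ ℝ.0#
        sum≈1       : sum weight ℝ.≈ ℝ.1#
        combination : ∀ k → sum (λ j → weight j ℝ.* X j k) ℝ.≈ p k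

    -- Subsets of the point set are subsets of the index set Fin n.
    record IsTverbergPartition {r} (Y : Subset n) (Ys : Vec (Subset n) r) :
                               Set (c ⊔ ℓ₁ ⊔ ℓ₂) where
      field
        disjoint     : ∀ {i j} → i ≢ j → Empty (lookup Ys i ∩ lookup Ys j)
        union        : ⋃ (toList Ys) ≡ Y
        intersecting : ∃ λ (p : Point d) → ∀ i → p ∈conv lookup Ys i

    delete : ∀ {r} → Fin n → Vec (Subset n) r → Vec (Subset n) r
    delete x = map (_- x)

    record RGAdjacent {r} (Ys Zs : Vec (Subset n) r) : Set (c ⊔ ℓ₁ ⊔ ℓ₂) where
      field
        vertexˡ  : IsTverbergPartition ⊤ Ys
        vertexʳ  : IsTverbergPartition ⊤ Zs
        x        : Fin n
        differ   : Ys ≢ Zs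
        onlyAt   : delete x Ys ≡ delete x Zs
        deletedˡ : IsTverbergPartition (⊤ - x) (delete x Ys)
        deletedʳ : IsTverbergPartition (⊤ - x) (delete x Zs)

    RGTv : (r : ℕ) → Graph (Vec (Subset n) r) (c ⊔ ℓ₁ ⊔ ℓ₂) (c ⊔ ℓ₁ ⊔ ℓ₂)
    RGTv r = record
      { IsVertex   = IsTverbergPartition ⊤
      ; Adjacent   = RGAdjacent
      ; endpoints  = λ e → RGAdjacent.vertexˡ e , RGAdjacent.vertexʳ e
      ; adj-sym    = λ e → let open RGAdjacent e in record
          { vertexˡ  = vertexʳ
          ; vertexʳ  = vertexˡ
          ; x        = x
          ; differ   = ≢-sym differ
          ; onlyAt   = sym onlyAt
          ; deletedˡ = deletedʳ
          ; deletedʳ = deletedˡ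
          }
      ; adj-irrefl = λ e → RGAdjacent.differ e refl
      }

{-# OPTIONS --safe #-}
-- Sarkaria's lift turns each point into r vectors of a space of dimension D = (d+1)(r-1)+1, such
-- that assigning the points to r classes gives a Tverberg partition iff a fixed vector z lies in
-- the cone of the n ≥ D+1 chosen vectors.  For an assignment s and an index x let ρ(s∖x) be the
-- squared distance of z to the cone of the vectors chosen at the indices other than x.  Any two
-- assignments are joined by changing one value at a time; the height of such a step at x is
-- ρ(s∖x), and the steps of height 0 are the edges of the graph.  A mountain-pass argument lowers
-- the maximal height M > 0 of a path: by Carathéodory's theorem the nearest point of height M is
-- carried by few indices, so that a second index y ≠ x is free, and moving y to a class whose
-- vector has positive inner product with the residual passes below M.  If all vectors at a vertex
-- of the path lie on the supporting hyperplane, the free indices are linked to each other along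
-- the boundary of the polytope of representations of the nearest point.  There are finitely many
-- heights, so the process ends at 0.
module Submission where

open import Defs
open import Algebra.Bundles using (CommutativeRing)
open import Algebra.Bundles.Raw using (RawRing)
import Algebra.Properties.AbelianGroup as AbelianGroupProperties
import Algebra.Properties.Ring as RingProperties
import Algebra.Properties.Semiring.Mult.TCOptimised as SemiringMult
import Algebra.Properties.Semiring.Sum as SemiringSum
import Algebra.Solver.Ring
open import Algebra.Solver.Ring.AlmostCommutativeRing using (_-Raw-AlmostCommutative⟶_; fromCommutativeRing)
import Algebra.Solver.Ring.NaturalCoefficients.Default as NaturalCoefficients
open import Data.Bool.Base using (if_then_else_)
import Data.Bool.Properties as Bool
open import Data.Fin.Base using (Fin; zero; suc; toℕ; fromℕ<; combine; remQuot; finToFun; funToFin)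
open import Data.Fin.Induction using (spo-wellFounded)
import Data.Fin.Properties as Fin
open import Data.Fin.Subset using (Subset; _∈_; _∉_; _∩_; ⁅_⁆; ⋃; ⊤; Empty) renaming (_-_ to _∖_)
import Data.Fin.Subset.Properties as Subset
open import Data.Maybe.Base using (Maybe; just; nothing)
open import Data.Nat.Base as ℕ using (ℕ)
import Data.Nat.Properties as ℕ
open import Data.Product.Base using (∃; _×_; _,_; proj₁; proj₂)
open import Data.Sum.Base using (_⊎_; inj₁; inj₂; [_,_]′)
open import Data.Vec.Base as Vec using (Vec; lookup; tabulate; toList; map)
open import Data.Vec.Functional using (Vector; _∷_; insertAt; removeAt; updateAt)
open import Data.Vec.Functional.Properties using (insertAt-lookup; removeAt-insertAt; updateAt-updates; updateAt-minimal)
import Data.Vec.Properties as Vec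
open import Function.Base using (_∘_; const)
open import Induction.WellFounded using (WellFounded; Acc; acc)
open import Level using (_⊔_)
open import Relation.Binary.Bundles using (StrictTotalOrder)
open import Relation.Binary.Construct.Closure.ReflexiveTransitive as Star using (Star; ε; _◅_; _◅◅_; gmap; kleisliStar; reverse)
open import Relation.Binary.Core using (Rel)
open import Relation.Binary.Definitions using (tri<; tri≈; tri>)
import Relation.Binary.Properties.StrictTotalOrder as STOProperties
open import Relation.Binary.PropositionalEquality as ≡ using (_≡_; _≢_)
import Relation.Binary.Reasoning.Setoid as SetoidReasoning
open import Relation.Nullary.Decidable using (Dec; yes; no; does; dec-true; ¬?; decidable-stable; _×-dec_)
open import Relation.Nullary.Negation using (¬_; contradiction)

-- A ring solver with integer coefficients for commutative rings.

module RingSolver {c ℓ} (R : CommutativeRing c ℓ) where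

  open CommutativeRing R
  open AbelianGroupProperties +-abelianGroup using (⁻¹-∙-comm)
  open RingProperties ring using (-0#≈0#; -‿involutive; -‿distribˡ-*; -‿distribʳ-*)
  open SemiringMult semiring using (×-homo-+; ×1-homo-*) renaming (_×_ to _·_)
  open SetoidReasoning setoid

  -- A pair stands for the integer `a - b`. The separate case `b = 0` makes the constants 0 and 1
  -- evaluate to `0#` and `1#` by computation.
  ⟦_⟧ : ℕ × ℕ → Carrier
  ⟦ a , 0 ⟧         = a · 1#
  ⟦ a , b@(ℕ.suc _) ⟧ = a · 1# - b · 1#

  ⟦⟧-unfold : ∀ a b → ⟦ a , b ⟧ ≈ a · 1# - b · 1#
  ⟦⟧-unfold a 0         = sym (trans (+-congˡ -0#≈0#) (+-identityʳ _))
  ⟦⟧-unfold a (ℕ.suc b) = refl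

  private
    -- This solver treats negated terms as atoms; it suffices to establish the solver with
    -- subtraction.
    module S = NaturalCoefficients commutativeSemiring
    open S using () renaming (_:+_ to _⊕_; _:*_ to _⊗_; _:=_ to _⊜_)

  ⟦⟧-cong : ∀ a b c d → a ℕ.+ d ≡ c ℕ.+ b → ⟦ a , b ⟧ ≈ ⟦ c , d ⟧
  ⟦⟧-cong a b c d eq = begin
    ⟦ a , b ⟧                            ≈⟨ ⟦⟧-unfold a b ⟩
    a · 1# - b · 1#                      ≈⟨ +-identityʳ _ ⟨
    (a · 1# - b · 1#) + 0#               ≈⟨ +-congˡ (-‿inverseʳ _) ⟨
    (a · 1# - b · 1#) + (d · 1# - d · 1#)
      ≈⟨ S.solve 4 (λ a b d e → (a ⊕ b) ⊕ (d ⊕ e) ⊜ (a ⊕ d) ⊕ (b ⊕ e)) refl _ _ _ _ ⟩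
    (a · 1# + d · 1#) + (- (b · 1#) - d · 1#) ≈⟨ +-congʳ (×-homo-+ 1# a d) ⟨
    (a ℕ.+ d) · 1# + (- (b · 1#) - d · 1#) ≡⟨ ≡.cong (λ n → n · 1# + (- (b · 1#) - d · 1#)) eq ⟩
    (c ℕ.+ b) · 1# + (- (b · 1#) - d · 1#) ≈⟨ +-congʳ (×-homo-+ 1# c b) ⟩
    (c · 1# + b · 1#) + (- (b · 1#) - d · 1#)
      ≈⟨ S.solve 4 (λ c b e f → (c ⊕ b) ⊕ (e ⊕ f) ⊜ (c ⊕ f) ⊕ (b ⊕ e)) refl _ _ _ _ ⟩
    (c · 1# - d · 1#) + (b · 1# - b · 1#) ≈⟨ +-congˡ (-‿inverseʳ _) ⟩
    (c · 1# - d · 1#) + 0#               ≈⟨ +-identityʳ _ ⟩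
    c · 1# - d · 1#                      ≈⟨ ⟦⟧-unfold c d ⟨
    ⟦ c , d ⟧                            ∎

  -- Solver normal forms are compared syntactically, so the coefficients must be canonical.
  cancel : ℕ × ℕ → ℕ × ℕ
  cancel (ℕ.suc a , ℕ.suc b) = cancel (a , b)
  cancel (a , b)             = a , b

  ⟦cancel⟧ : ∀ a b → ⟦ cancel (a , b) ⟧ ≈ ⟦ a , b ⟧
  ⟦cancel⟧ (ℕ.suc a) (ℕ.suc b) = trans (⟦cancel⟧ a b) (⟦⟧-cong a b (ℕ.suc a) (ℕ.suc b) (ℕ.+-suc a b))
  ⟦cancel⟧ 0         b         = refl
  ⟦cancel⟧ (ℕ.suc a) 0         = refl

  differences : RawRing _ _
  differences = record
    { Carrier = ℕ × ℕ
    ; _≈_ = _≡_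
    ; _+_ = λ { (a , b) (c , d) → cancel (a ℕ.+ c , b ℕ.+ d) }
    ; _*_ = λ { (a , b) (c , d) → cancel (a ℕ.* c ℕ.+ b ℕ.* d , a ℕ.* d ℕ.+ b ℕ.* c) }
    ; -_  = λ { (a , b) → b , a }
    ; 0#  = 0 , 0
    ; 1#  = 1 , 0
    }

  ⟦⟧-homo : differences -Raw-AlmostCommutative⟶ fromCommutativeRing R
  ⟦⟧-homo = record
    { ⟦_⟧    = ⟦_⟧
    ; +-homo = λ { (a , b) (c , d) → begin
        ⟦ cancel (a ℕ.+ c , b ℕ.+ d) ⟧                 ≈⟨ ⟦cancel⟧ (a ℕ.+ c) (b ℕ.+ d) ⟩
        ⟦ a ℕ.+ c , b ℕ.+ d ⟧                          ≈⟨ ⟦⟧-unfold (a ℕ.+ c) (b ℕ.+ d) ⟩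
        (a ℕ.+ c) · 1# - (b ℕ.+ d) · 1#                ≈⟨ +-cong (×-homo-+ 1# a c) (-‿cong (×-homo-+ 1# b d)) ⟩
        (a · 1# + c · 1#) - (b · 1# + d · 1#)          ≈⟨ +-congˡ (⁻¹-∙-comm _ _) ⟨
        (a · 1# + c · 1#) + (- (b · 1#) - d · 1#)
          ≈⟨ S.solve 4 (λ a b c d → (a ⊕ c) ⊕ (b ⊕ d) ⊜ (a ⊕ b) ⊕ (c ⊕ d)) refl _ _ _ _ ⟩
        (a · 1# - b · 1#) + (c · 1# - d · 1#)          ≈⟨ +-cong (⟦⟧-unfold a b) (⟦⟧-unfold c d) ⟨
        ⟦ a , b ⟧ + ⟦ c , d ⟧                          ∎ }
    ; *-homo = λ { (a , b) (c , d) → begin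
        ⟦ cancel (a ℕ.* c ℕ.+ b ℕ.* d , a ℕ.* d ℕ.+ b ℕ.* c) ⟧
          ≈⟨ ⟦cancel⟧ (a ℕ.* c ℕ.+ b ℕ.* d) (a ℕ.* d ℕ.+ b ℕ.* c) ⟩
        ⟦ a ℕ.* c ℕ.+ b ℕ.* d , a ℕ.* d ℕ.+ b ℕ.* c ⟧  ≈⟨ ⟦⟧-unfold (a ℕ.* c ℕ.+ b ℕ.* d) (a ℕ.* d ℕ.+ b ℕ.* c) ⟩
        (a ℕ.* c ℕ.+ b ℕ.* d) · 1# - (a ℕ.* d ℕ.+ b ℕ.* c) · 1#
          ≈⟨ +-cong (products a c b d) (-‿cong (products a d b c)) ⟩
        (a · 1# * (c · 1#) + b · 1# * (d · 1#)) - (a · 1# * (d · 1#) + b · 1# * (c · 1#))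
          ≈⟨ +-cong (+-congˡ (*-cong (-‿involutive _) (-‿involutive _))) (⁻¹-∙-comm _ _) ⟨
        (a · 1# * (c · 1#) + - (- (b · 1#)) * - (- (d · 1#))) + (- (a · 1# * (d · 1#)) - b · 1# * (c · 1#))
          ≈⟨ +-cong (+-congˡ (trans (sym (-‿distribˡ-* _ _)) (trans (-‿distribʳ-* _ _) (*-congˡ (-‿involutive _)))))
                    (+-cong (-‿distribʳ-* _ _) (-‿distribˡ-* _ _)) ⟩
        (a · 1# * (c · 1#) + - (b · 1#) * - (d · 1#)) + (a · 1# * - (d · 1#) + - (b · 1#) * (c · 1#))
          ≈⟨ S.solve 4 (λ a b c d → (a ⊗ c ⊕ b ⊗ d) ⊕ (a ⊗ d ⊕ b ⊗ c) ⊜ (a ⊕ b) ⊗ (c ⊕ d)) refl _ _ _ _ ⟩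
        (a · 1# - b · 1#) * (c · 1# - d · 1#)          ≈⟨ *-cong (⟦⟧-unfold a b) (⟦⟧-unfold c d) ⟨
        ⟦ a , b ⟧ * ⟦ c , d ⟧                          ∎ }
    ; -‿homo = λ { (a , b) → begin
        ⟦ b , a ⟧                  ≈⟨ ⟦⟧-unfold b a ⟩
        b · 1# - a · 1#            ≈⟨ +-comm _ _ ⟩
        - (a · 1#) + b · 1#        ≈⟨ +-congˡ (-‿involutive _) ⟨
        - (a · 1#) - - (b · 1#)    ≈⟨ ⁻¹-∙-comm _ _ ⟩
        - (a · 1# - b · 1#)        ≈⟨ -‿cong (⟦⟧-unfold a b) ⟨
        - ⟦ a , b ⟧                ∎ }
    ; 0-homo = refl
    ; 1-homo = refl
    }
    where
    products : ∀ a c b d → (a ℕ.* c ℕ.+ b ℕ.* d) · 1# ≈ a · 1# * (c · 1#) + b · 1# * (d · 1#)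
    products a c b d = trans (×-homo-+ 1# (a ℕ.* c) (b ℕ.* d)) (+-cong (×1-homo-* a c) (×1-homo-* b d))

  ⟦⟧-≟ : ∀ x y → Maybe (⟦ x ⟧ ≈ ⟦ y ⟧)
  ⟦⟧-≟ (a , b) (c , d) with a ℕ.+ d ℕ.≟ c ℕ.+ b
  ... | no  _  = nothing
  ... | yes eq = just (⟦⟧-cong a b c d eq)

  open Algebra.Solver.Ring differences (fromCommutativeRing R) ⟦⟧-homo ⟦⟧-≟ public
    using (solve; _:+_; _:*_; _:-_; :-_; _:=_; con)

-- Ordered fields: inequalities, finite sums and minima.

module OrderedField {ℓ ℓ₁ ℓ₂} (ℝ : CompleteOrderedField ℓ ℓ₁ ℓ₂) where

  open CompleteOrderedField ℝ public hiding (_≤_; zero)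
  open RingProperties ring using (-0#≈0#; -‿involutive; -‿distribˡ-*; -‿distribʳ-*) public
  open SemiringSum semiring public
    using (sum; sum-cong-≋; sum-replicate-zero; sum-remove; ∑-distrib-+; ∑-comm; *-distribˡ-sum; *-distribʳ-sum)
  module ≈-Reasoning = SetoidReasoning setoid

  open RingSolver commutativeRing public using (solve; _:+_; _:*_; _:-_; :-_; _:=_; con)

  strictTotalOrder : StrictTotalOrder _ _ _
  strictTotalOrder = record { isStrictTotalOrder = isStrictTotalOrder }

  open StrictTotalOrder strictTotalOrder public
    using (compare; _≟_; _<?_)
    renaming (irrefl to <-irrefl; trans to <-trans; <-respʳ-≈ to <-respʳ; <-respˡ-≈ to <-respˡ)

  open STOProperties strictTotalOrder public
    using (_≤_; _≤?_; antisym)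
    renaming (refl to ≤-refl; trans to ≤-trans; total to ≤-total
             ; ≤-respˡ-≈ to ≤-respˡ; ≤-respʳ-≈ to ≤-respʳ)

  private
    variable
      x y z : Carrier
      n : ℕ

  <⇒≤ : x < y → x ≤ y
  <⇒≤ = inj₁

  ≈⇒≤ : x ≈ y → x ≤ y
  ≈⇒≤ = inj₂

  <⇒≱ : x < y → ¬ y ≤ x
  <⇒≱ x<y (inj₁ y<x) = <-irrefl refl (<-trans x<y y<x)
  <⇒≱ x<y (inj₂ y≈x) = <-irrefl (sym y≈x) x<y

  ≮⇒≥ : ¬ x < y → y ≤ x
  ≮⇒≥ {x} {y} x≮y with compare x y
  ... | tri< x<y _ _ = contradiction x<y x≮y
  ... | tri≈ _ x≈y _ = inj₂ (sym x≈y)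
  ... | tri> _ _ y<x = inj₁ y<x

  ≰⇒> : ¬ x ≤ y → y < x
  ≰⇒> {x} {y} x≰y with compare x y
  ... | tri< x<y _ _ = contradiction (inj₁ x<y) x≰y
  ... | tri≈ _ x≈y _ = contradiction (inj₂ x≈y) x≰y
  ... | tri> _ _ y<x = y<x

  <-≤-trans : x < y → y ≤ z → x < z
  <-≤-trans x<y (inj₁ y<z) = <-trans x<y y<z
  <-≤-trans x<y (inj₂ y≈z) = <-respʳ y≈z x<y

  ≤-<-trans : x ≤ y → y < z → x < z
  ≤-<-trans (inj₁ x<y) y<z = <-trans x<y y<z
  ≤-<-trans (inj₂ x≈y) y<z = <-respˡ (sym x≈y) y<z

  +-monoʳ-≤ : ∀ z → x ≤ y → x + z ≤ y + z
  +-monoʳ-≤ z (inj₁ x<y) = inj₁ (+-monoˡ-< z x<y)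
  +-monoʳ-≤ z (inj₂ x≈y) = inj₂ (+-congʳ x≈y)

  x≤y⇒0≤y-x : x ≤ y → 0# ≤ y - x
  x≤y⇒0≤y-x {x} x≤y = ≤-respˡ (-‿inverseʳ x) (+-monoʳ-≤ (- x) x≤y)

  x<y⇒0<y-x : x < y → 0# < y - x
  x<y⇒0<y-x {x} x<y = <-respˡ (-‿inverseʳ x) (+-monoˡ-< (- x) x<y)

  -- With the difference `d` given as a witness, an inequality reduces to a sign condition and a
  -- ring identity.
  ≤-step : ∀ {d} → 0# ≤ d → x + d ≈ y → x ≤ y
  ≤-step {x} 0≤d x+d≈y =
    ≤-respˡ (+-identityˡ x) (≤-respʳ (trans (+-comm _ x) x+d≈y) (+-monoʳ-≤ x 0≤d))

  <-step : ∀ {d} → 0# < d → x + d ≈ y → x < y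
  <-step {x} 0<d x+d≈y =
    <-respˡ (+-identityˡ x) (<-respʳ (trans (+-comm _ x) x+d≈y) (+-monoˡ-< x 0<d))

  x≤0⇒0≤-x : x ≤ 0# → 0# ≤ - x
  x≤0⇒0≤-x {x} x≤0 = ≤-respʳ (+-identityˡ (- x)) (x≤y⇒0≤y-x x≤0)

  x<0⇒0<-x : x < 0# → 0# < - x
  x<0⇒0<-x {x} x<0 = <-respʳ (+-identityˡ (- x)) (x<y⇒0<y-x x<0)

  0<x⇒-x<0 : 0# < x → - x < 0#
  0<x⇒-x<0 {x} 0<x = <-step 0<x (-‿inverseˡ x)

  +-nonneg : 0# ≤ x → 0# ≤ y → 0# ≤ x + y
  +-nonneg {x} {y} 0≤x 0≤y = ≤-trans 0≤y (≤-step 0≤x (+-comm y x))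

  *-nonneg : 0# ≤ x → 0# ≤ y → 0# ≤ x * y
  *-nonneg (inj₁ 0<x) (inj₁ 0<y) = inj₁ (*-pos 0<x 0<y)
  *-nonneg (inj₁ 0<x) (inj₂ 0≈y) = inj₂ (sym (trans (*-congˡ (sym 0≈y)) (zeroʳ _)))
  *-nonneg (inj₂ 0≈x) _          = inj₂ (sym (trans (*-congʳ (sym 0≈x)) (zeroˡ _)))

  *-nonneg-nonpos : 0# ≤ x → y ≤ 0# → x * y ≤ 0#
  *-nonneg-nonpos {x} {y} 0≤x y≤0 = ≤-step (*-nonneg 0≤x (x≤0⇒0≤-x y≤0))
    (solve 2 (λ x y → x :* y :+ x :* (:- y) := con (0 , 0)) refl x y)

  *-pos-neg : 0# < x → y < 0# → x * y < 0#
  *-pos-neg {x} {y} 0<x y<0 = <-step (*-pos 0<x (x<0⇒0<-x y<0))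
    (solve 2 (λ x y → x :* y :+ x :* (:- y) := con (0 , 0)) refl x y)

  square-nonneg : ∀ x → 0# ≤ x * x
  square-nonneg x with ≤-total 0# x
  ... | inj₁ 0≤x = *-nonneg 0≤x 0≤x
  ... | inj₂ x≤0 = ≤-respʳ (solve 1 (λ x → (:- x) :* (:- x) := x :* x) refl x)
                     (*-nonneg (x≤0⇒0≤-x x≤0) (x≤0⇒0≤-x x≤0))

  *-cancelʳ-nonneg : 0# < y → 0# ≤ x * y → 0# ≤ x
  *-cancelʳ-nonneg {y} {x} 0<y 0≤xy = ≮⇒≥ λ x<0 →
    <⇒≱ (<-respˡ (*-comm y x) (*-pos-neg 0<y x<0)) 0≤xy

  *-zeroˡ-pos : 0# < y → x * y ≈ 0# → x ≈ 0#
  *-zeroˡ-pos {y} {x} 0<y xy≈0 with compare x 0#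
  ... | tri< x<0 _ _ = contradiction (trans (*-comm y x) xy≈0) λ e → <-irrefl e (*-pos-neg 0<y x<0)
  ... | tri≈ _ x≈0 _ = x≈0
  ... | tri> _ _ 0<x = contradiction (*-pos 0<x 0<y) (<-irrefl (sym xy≈0))

  square-zero : x * x ≈ 0# → x ≈ 0#
  square-zero {x} xx≈0 with compare x 0#
  ... | tri< x<0 _ _ = contradiction (*-pos (x<0⇒0<-x x<0) (x<0⇒0<-x x<0))
        (<-irrefl (sym (trans (solve 1 (λ x → (:- x) :* (:- x) := x :* x) refl x) xx≈0)))
  ... | tri≈ _ x≈0 _ = x≈0
  ... | tri> _ _ 0<x = *-zeroˡ-pos 0<x xx≈0

  x-y≈0⇒x≈y : x - y ≈ 0# → x ≈ y
  x-y≈0⇒x≈y {x} {y} eq = trans (solve 2 (λ x y → x := (x :- y) :+ y) refl x y) (trans (+-congʳ eq) (+-identityˡ y))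

  -- The junk value 0⁻¹ = 0 makes the inverse total.
  infix 9 _⁻¹
  _⁻¹ : Carrier → Carrier
  x ⁻¹ with x ≟ 0#
  ... | yes _  = 0#
  ... | no x≉0 = proj₁ (inverse x x≉0)

  *-inverseʳ : 0# < x → x * x ⁻¹ ≈ 1#
  *-inverseʳ {x} 0<x with x ≟ 0#
  ... | yes x≈0 = contradiction 0<x (<-irrefl (sym x≈0))
  ... | no x≉0  = proj₂ (inverse x x≉0)

  ⁻¹-pos : 0# < x → 0# < x ⁻¹
  ⁻¹-pos {x} 0<x = ≰⇒> λ x⁻¹≤0 → <⇒≱ 0<1 (≤-respˡ (*-inverseʳ 0<x) (*-nonneg-nonpos (<⇒≤ 0<x) x⁻¹≤0))

  sum-cong : {f g : Vector Carrier n} → (∀ i → f i ≈ g i) → sum f ≈ sum g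
  sum-cong = sum-cong-≋

  sum-zero : {f : Vector Carrier n} → (∀ i → f i ≈ 0#) → sum f ≈ 0#
  sum-zero {n} f≈0 = trans (sum-cong f≈0) (sum-replicate-zero n)

  sum-nonneg : {f : Vector Carrier n} → (∀ i → 0# ≤ f i) → 0# ≤ sum f
  sum-nonneg {ℕ.zero}  0≤f = ≤-refl
  sum-nonneg {ℕ.suc n} 0≤f = +-nonneg (0≤f zero) (sum-nonneg (0≤f ∘ suc))

  sum-nonneg-zero : {f : Vector Carrier n} → (∀ i → 0# ≤ f i) → sum f ≈ 0# → ∀ i → f i ≈ 0#
  sum-nonneg-zero {ℕ.suc n} {f} 0≤f sum≈0 = λ where
      zero    → f₀≈0
      (suc i) → sum-nonneg-zero (0≤f ∘ suc)
                  (trans (sym (+-identityˡ _)) (trans (+-congʳ (sym f₀≈0)) sum≈0)) i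
    where
    f₀≈0 : f zero ≈ 0#
    f₀≈0 = antisym (≤-step (sum-nonneg (0≤f ∘ suc)) sum≈0) (0≤f zero)

  sum-neg : (f : Vector Carrier n) → sum (λ i → - f i) ≈ - sum f
  sum-neg {ℕ.zero}  f = sym -0#≈0#
  sum-neg {ℕ.suc n} f = trans (+-congˡ (sum-neg (f ∘ suc))) (solve 2 (λ x y → :- x :+ (:- y) := :- (x :+ y)) refl _ _)

  sum-nonpos : {f : Vector Carrier n} → (∀ i → f i ≤ 0#) → sum f ≤ 0#
  sum-nonpos {f = f} f≤0 = ≤-step (sum-nonneg (x≤0⇒0≤-x ∘ f≤0)) (trans (+-congˡ (sum-neg f)) (-‿inverseʳ _))

  sum-nonpos-zero : {f : Vector Carrier n} → (∀ i → f i ≤ 0#) → sum f ≈ 0# → ∀ i → f i ≈ 0#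
  sum-nonpos-zero {f = f} f≤0 sum≈0 i = trans (sym (-‿involutive _)) (trans (-‿cong -f≈0) -0#≈0#)
    where
    -f≈0 : - f i ≈ 0#
    -f≈0 = sum-nonneg-zero (x≤0⇒0≤-x ∘ f≤0) (trans (sum-neg f) (trans (-‿cong sum≈0) -0#≈0#)) i

  -- The restriction to a decidable subset serves the ratio tests and first crossings below, where
  -- only some indices compete.
  argmin : ∀ {q} {Q : Fin n → Set q} → (∀ i → Dec (Q i)) → (f : Fin n → Carrier) → ∃ Q →
           ∃ λ i → Q i × (∀ j → Q j → f i ≤ f j)
  argmin {ℕ.suc n} {Q = Q} Q? f (k , Qk) with Fin.any? (Q? ∘ suc)
  ... | no none = zero , Q0 k Qk , λ where
      zero    _  → ≤-refl
      (suc j) Qj → contradiction (j , Qj) none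
    where
    Q0 : ∀ k → Q k → Q zero
    Q0 zero    Qk = Qk
    Q0 (suc k) Qk = contradiction (k , Qk) none
  ... | yes some with argmin (Q? ∘ suc) (f ∘ suc) some
  ... | i , Qi , min with Q? zero
  ... | no ¬Q0 = suc i , Qi , λ where
      zero    Q0 → contradiction Q0 ¬Q0
      (suc j) Qj → min j Qj
  ... | yes Q0 with ≤-total (f zero) (f (suc i))
  ... | inj₁ f0≤fi = zero , Q0 , λ where
      zero    _  → ≤-refl
      (suc j) Qj → ≤-trans f0≤fi (min j Qj)
  ... | inj₂ fi≤f0 = suc i , Qi , λ where
      zero    _  → fi≤f0
      (suc j) Qj → min j Qj

-- Linear dependencies and nearest points in finitely generated cones.

module LinearAlgebra {ℓ ℓ₁ ℓ₂} (ℝ : CompleteOrderedField ℓ ℓ₁ ℓ₂) where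

  open OrderedField ℝ
  open ≈-Reasoning

  private
    variable
      D m n : ℕ

  infix  8 _∙_
  infixl 6 _⊖_
  infixr 7 _⊙_

  _∙_ : Vector Carrier D → Vector Carrier D → Carrier
  u ∙ v = sum λ e → u e * v e

  _⊖_ : Vector Carrier D → Vector Carrier D → Vector Carrier D
  (u ⊖ v) e = u e - v e

  _⊙_ : Carrier → Vector Carrier D → Vector Carrier D
  (k ⊙ u) e = k * u e

  lin : Vector Carrier m → Vector (Vector Carrier D) m → Vector Carrier D
  lin a g e = sum λ i → a i * g i e

  ∙-cong : {u u′ v v′ : Vector Carrier D} → (∀ e → u e ≈ u′ e) → (∀ e → v e ≈ v′ e) → u ∙ v ≈ u′ ∙ v′
  ∙-cong u≈u′ v≈v′ = sum-cong λ e → *-cong (u≈u′ e) (v≈v′ e)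

  ∙-congˡ : (w : Vector Carrier D) {u v : Vector Carrier D} → (∀ e → u e ≈ v e) → w ∙ u ≈ w ∙ v
  ∙-congˡ w = ∙-cong {u = w} (λ _ → refl)

  ∙-congʳ : (w : Vector Carrier D) {u v : Vector Carrier D} → (∀ e → u e ≈ v e) → u ∙ w ≈ v ∙ w
  ∙-congʳ w u≈v = ∙-cong {v = w} u≈v (λ _ → refl)

  ∙-comm : (u v : Vector Carrier D) → u ∙ v ≈ v ∙ u
  ∙-comm u v = sum-cong λ e → *-comm (u e) (v e)

  ∙-+ˡ : (u v w : Vector Carrier D) → (λ e → u e + v e) ∙ w ≈ u ∙ w + v ∙ w
  ∙-+ˡ {D} u v w = trans (sum-cong λ e → distribʳ (w e) (u e) (v e)) (∑-distrib-+ {D} _ _)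

  ∙-⊙ˡ : ∀ k (u w : Vector Carrier D) → (k ⊙ u) ∙ w ≈ k * u ∙ w
  ∙-⊙ˡ {D} k u w = trans (sum-cong λ e → *-assoc k (u e) (w e)) (sym (*-distribˡ-sum {D} k _))

  ∙-⊖ˡ : (u v w : Vector Carrier D) → (u ⊖ v) ∙ w ≈ u ∙ w - v ∙ w
  ∙-⊖ˡ {D} u v w = begin
    (u ⊖ v) ∙ w
      ≈⟨ sum-cong (λ e → solve 3 (λ u v w → (u :- v) :* w := u :* w :+ :- (v :* w)) refl (u e) (v e) (w e)) ⟩
    sum (λ e → u e * w e + - (v e * w e))          ≈⟨ ∑-distrib-+ {D} _ _ ⟩
    u ∙ w + sum (λ e → - (v e * w e))              ≈⟨ +-congˡ (sum-neg {D} _) ⟩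
    u ∙ w - v ∙ w                                  ∎

  ∙-lin : (a : Vector Carrier m) (g : Vector (Vector Carrier D) m) (w : Vector Carrier D) →
          lin a g ∙ w ≈ sum λ i → a i * g i ∙ w
  ∙-lin {m} {D} a g w = begin
    sum (λ e → sum (λ i → a i * g i e) * w e)      ≈⟨ sum-cong (λ e → *-distribʳ-sum (w e) (λ i → a i * g i e)) ⟩
    sum (λ e → sum (λ i → a i * g i e * w e))      ≈⟨ ∑-comm {D} {m} _ ⟩
    sum (λ i → sum (λ e → a i * g i e * w e))      ≈⟨ sum-cong (λ i → sum-cong (λ e → *-assoc (a i) (g i e) (w e))) ⟩
    sum (λ i → sum (λ e → a i * (g i e * w e)))    ≈⟨ sum-cong (λ i → *-distribˡ-sum {D} (a i) _) ⟨
    sum (λ i → a i * g i ∙ w)                      ∎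

  ∙-square-⊖ : (u v : Vector Carrier D) → (u ⊖ v) ∙ (u ⊖ v) ≈ u ∙ u - u ∙ v - u ∙ v + v ∙ v
  ∙-square-⊖ u v = begin
    (u ⊖ v) ∙ (u ⊖ v)                    ≈⟨ ∙-⊖ˡ u v (u ⊖ v) ⟩
    u ∙ (u ⊖ v) - v ∙ (u ⊖ v)            ≈⟨ +-cong (expand u) (-‿cong (expand v)) ⟩
    (u ∙ u - v ∙ u) - (u ∙ v - v ∙ v)    ≈⟨ +-congʳ (+-congˡ (-‿cong (∙-comm v u))) ⟩
    (u ∙ u - u ∙ v) - (u ∙ v - v ∙ v)    ≈⟨ solve 3 (λ a b c → (a :- b) :- (b :- c) := a :- b :- b :+ c) refl _ _ _ ⟩
    u ∙ u - u ∙ v - u ∙ v + v ∙ v        ∎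
    where
    expand : ∀ w → w ∙ (u ⊖ v) ≈ u ∙ w - v ∙ w
    expand w = trans (∙-comm w (u ⊖ v)) (∙-⊖ˡ u v w)

  ∙-square-nonneg : (u : Vector Carrier D) → 0# ≤ u ∙ u
  ∙-square-nonneg u = sum-nonneg λ e → square-nonneg (u e)

  ∙-square-zero : (u : Vector Carrier D) → u ∙ u ≈ 0# → ∀ e → u e ≈ 0#
  ∙-square-zero u uu≈0 e = square-zero (sum-nonneg-zero (λ e → square-nonneg (u e)) uu≈0 e)

  lin-+ : (a b : Vector Carrier m) (g : Vector (Vector Carrier D) m) → ∀ e →
          lin (λ i → a i + b i) g e ≈ lin a g e + lin b g e
  lin-+ {m} a b g e = trans (sum-cong λ i → distribʳ (g i e) (a i) (b i)) (∑-distrib-+ {m} _ _)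

  lin-⊙ : ∀ k (a : Vector Carrier m) (g : Vector (Vector Carrier D) m) → ∀ e →
          lin (k ⊙ a) g e ≈ k * lin a g e
  lin-⊙ {m} k a g e = trans (sum-cong λ i → *-assoc k (a i) (g i e)) (sym (*-distribˡ-sum {m} k _))

  Dependency : Vector (Vector Carrier D) n → Vector Carrier n → Set _
  Dependency g k = (∃ λ i → ¬ (k i ≈ 0#)) × (∀ e → lin k g e ≈ 0#)

  -- Induction on the dimension: a first coordinate that vanishes everywhere is dropped; otherwise a
  -- pivot `g p` clears it from the other vectors, which costs one vector.
  dependency : D ℕ.< n → (g : Vector (Vector Carrier D) n) → ∃ (Dependency g)
  dependency {ℕ.zero} {ℕ.suc n} _ g =
    (λ _ → 1#) , (zero , λ 1≈0 → <-irrefl (sym 1≈0) 0<1) , λ ()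
  dependency {ℕ.suc D} {ℕ.suc n} (ℕ.s≤s D<n) g with Fin.any? (λ i → ¬? (g i zero ≟ 0#))
  ... | no allZero with dependency (ℕ.m<n⇒m<1+n D<n) (λ i → g i ∘ suc)
  ... | k , k≉0 , dep = k , k≉0 , λ where
      zero    → sum-zero λ i → trans (*-congˡ (decidable-stable (g i zero ≟ 0#) λ gi≉0 → allZero (i , gi≉0))) (zeroʳ (k i))
      (suc e) → dep e
  dependency {ℕ.suc D} {ℕ.suc n} (ℕ.s≤s D<n) g | yes (p , gp≉0) = k , k≉0 , dep
    where
    ι = proj₁ (inverse (g p zero) gp≉0)
    gₚι≈1 = proj₂ (inverse (g p zero) gp≉0)

    -- Gaussian elimination of the first coordinate.
    h : Vector (Vector Carrier (ℕ.suc D)) n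
    h j e = removeAt g p j e - removeAt g p j zero * ι * g p e

    IH = dependency D<n (λ j → h j ∘ suc)
    κ = proj₁ IH

    -- The pivot's coefficient collects the multiples of `g p` subtracted in `h`, so that `lin k g`
    -- equals `lin κ h`.
    κₚ : Carrier
    κₚ = - sum λ j → κ j * (removeAt g p j zero * ι)

    k : Vector Carrier (ℕ.suc n)
    k = insertAt κ p κₚ

    k-removeAt : ∀ j → removeAt k p j ≡.≡ κ j
    k-removeAt = removeAt-insertAt κ p κₚ

    k≉0 : ∃ λ i → ¬ (k i ≈ 0#)
    k≉0 with proj₁ (proj₂ IH)
    ... | j , κj≉0 = _ , λ kj≈0 → κj≉0 (trans (reflexive (≡.sym (k-removeAt j))) kj≈0)

    split : ∀ e → lin k g e ≈ lin κ h e
    split e = begin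
      lin k g e
        ≈⟨ sum-remove {i = p} (λ i → k i * g i e) ⟩
      k p * g p e + sum (λ j → removeAt k p j * removeAt g p j e)
        ≈⟨ +-cong (*-congʳ (reflexive (insertAt-lookup κ p κₚ))) (sum-cong λ j → *-congʳ (reflexive (k-removeAt j))) ⟩
      κₚ * g p e + sum (λ j → κ j * removeAt g p j e)
        ≈⟨ +-comm _ _ ⟩
      sum (λ j → κ j * removeAt g p j e) + κₚ * g p e
        ≈⟨ +-congˡ (trans (sym (-‿distribˡ-* _ _)) (trans (-‿cong (*-distribʳ-sum {n} (g p e) _)) (sym (sum-neg {n} _)))) ⟩
      sum (λ j → κ j * removeAt g p j e) + sum (λ j → - (κ j * (removeAt g p j zero * ι) * g p e))
        ≈⟨ ∑-distrib-+ {n} _ _ ⟨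
      sum (λ j → κ j * removeAt g p j e + - (κ j * (removeAt g p j zero * ι) * g p e))
        ≈⟨ sum-cong {n} (λ j → solve 5 (λ κ g g₀ ι p → κ :* g :+ :- (κ :* (g₀ :* ι) :* p) := κ :* (g :- g₀ :* ι :* p)) refl
                                 (κ j) (removeAt g p j e) (removeAt g p j zero) ι (g p e)) ⟩
      lin κ h e
        ∎

    h₀≈0 : ∀ j → h j zero ≈ 0#
    h₀≈0 j = begin
      g₀ - g₀ * ι * g p zero    ≈⟨ solve 3 (λ g ι p → g :- g :* ι :* p := g :- g :* (p :* ι)) refl g₀ ι (g p zero) ⟩
      g₀ - g₀ * (g p zero * ι)  ≈⟨ +-congˡ (-‿cong (trans (*-congˡ gₚι≈1) (*-identityʳ g₀))) ⟩
      g₀ - g₀                   ≈⟨ -‿inverseʳ g₀ ⟩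
      0#                        ∎
      where g₀ = removeAt g p j zero

    dep : ∀ e → lin k g e ≈ 0#
    dep zero    = trans (split zero) (sum-zero λ j → trans (*-congˡ (h₀≈0 j)) (zeroʳ (κ j)))
    dep (suc e) = trans (split (suc e)) (proj₂ (proj₂ IH) e)

  -- A point of the cone, given by its coefficients, and the residual `r` that it leaves; minimality
  -- of `r` is expressed separately by `Opt`.
  record Rep (z : Vector Carrier D) (g : Vector (Vector Carrier D) m) (r : Vector Carrier D)
             (a : Vector Carrier m) : Set (ℓ ⊔ ℓ₁ ⊔ ℓ₂) where
    constructor rep
    field
      nonneg : ∀ i → 0# ≤ a i
      decomp : ∀ e → z e ≈ lin a g e + r e

  -- The Karush–Kuhn–Tucker conditions for r to be z minus its nearest point in the cone of g.
  record Opt (z : Vector Carrier D) (g : Vector (Vector Carrier D) m) (r : Vector Carrier D) :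
             Set (ℓ ⊔ ℓ₁ ⊔ ℓ₂) where
    constructor opt
    field
      nonpos : ∀ i → g i ∙ r ≤ 0#
      orthogonal : z ∙ r ≈ r ∙ r

  decomp-∙ : {z : Vector Carrier D} (g : Vector (Vector Carrier D) m) {r : Vector Carrier D} (a : Vector Carrier m) →
             (∀ e → z e ≈ lin a g e + r e) → ∀ w → z ∙ w ≈ sum (λ i → a i * g i ∙ w) + r ∙ w
  decomp-∙ {z = z} g {r} a eq w = begin
    z ∙ w                                ≈⟨ ∙-congʳ w eq ⟩
    (λ e → lin a g e + r e) ∙ w          ≈⟨ ∙-+ˡ (lin a g) r w ⟩
    lin a g ∙ w + r ∙ w                  ≈⟨ +-congʳ (∙-lin a g w) ⟩
    sum (λ i → a i * g i ∙ w) + r ∙ w    ∎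

  weighted-nonpos : {a f : Vector Carrier m} → (∀ i → 0# ≤ a i) → (∀ i → f i ≤ 0#) → sum (λ i → a i * f i) ≤ 0#
  weighted-nonpos 0≤a f≤0 = sum-nonpos λ i → *-nonneg-nonpos (0≤a i) (f≤0 i)

  module _ {z : Vector Carrier D} {g : Vector (Vector Carrier D) m} where

    -- Pairing the decomposition of `z` with `r` gives `r′ ∙ r ≈ r ∙ r - S` with `S ≤ 0`, so the
    -- cross term of the expanded square has the right sign.
    opt-≤ : ∀ {r r′ a} → Opt z g r → Rep z g r′ a → (r′ ⊖ r) ∙ (r′ ⊖ r) + r ∙ r ≤ r′ ∙ r′
    opt-≤ {r} {r′} {a} (opt g∙r≤0 zr≈rr) (rep 0≤a eq) =
      ≤-step (x≤0⇒0≤-x S+S≤0) (begin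
        (r′ ⊖ r) ∙ (r′ ⊖ r) + r ∙ r + - (S + S)
          ≈⟨ +-congʳ (+-congʳ (∙-square-⊖ r′ r)) ⟩
        (r′ ∙ r′ - r′ ∙ r - r′ ∙ r + r ∙ r) + r ∙ r + - (S + S)
          ≈⟨ solve 4 (λ A B C S → (A :- B :- B :+ C) :+ C :+ :- (S :+ S) := A :+ ((C :- (S :+ B)) :+ (C :- (S :+ B)))) refl _ _ _ _ ⟩
        r′ ∙ r′ + ((r ∙ r - (S + r′ ∙ r)) + (r ∙ r - (S + r′ ∙ r)))
          ≈⟨ +-congˡ (trans (+-cong diff diff) (+-identityʳ 0#)) ⟩
        r′ ∙ r′ + 0#
          ≈⟨ +-identityʳ _ ⟩
        r′ ∙ r′
          ∎)
      where
      S = sum λ i → a i * g i ∙ r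
      S≤0 : S ≤ 0#
      S≤0 = weighted-nonpos 0≤a g∙r≤0
      S+S≤0 : S + S ≤ 0#
      S+S≤0 = ≤-trans (≤-respʳ (+-identityˡ S) (+-monoʳ-≤ S S≤0)) S≤0
      diff : r ∙ r - (S + r′ ∙ r) ≈ 0#
      diff = trans (+-congʳ (trans (sym zr≈rr) (decomp-∙ g a eq r))) (-‿inverseʳ _)

    -- Complementary slackness: the terms are nonpositive, and `z ∙ r ≈ r ∙ r` forces their sum to
    -- vanish.
    complementary : ∀ {r a} → Opt z g r → Rep z g r a → ∀ i → a i * g i ∙ r ≈ 0#
    complementary {r} {a} (opt g∙r≤0 zr≈rr) (rep 0≤a eq) =
      sum-nonpos-zero (λ i → *-nonneg-nonpos (0≤a i) (g∙r≤0 i)) (begin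
        sum (λ i → a i * g i ∙ r)                      ≈⟨ solve 2 (λ x y → x := (x :+ y) :- y) refl _ _ ⟩
        (sum (λ i → a i * g i ∙ r) + r ∙ r) - r ∙ r    ≈⟨ +-congʳ (decomp-∙ g a eq r) ⟨
        z ∙ r - r ∙ r                                  ≈⟨ +-congʳ zr≈rr ⟩
        r ∙ r - r ∙ r                                  ≈⟨ -‿inverseʳ _ ⟩
        0#                                             ∎)

  -- Existence by induction on the generators, without compactness. If the residual `r′` for the
  -- other generators satisfies `g₀ ∙ r′ ≤ 0`, it stays optimal. Otherwise the problem is projected
  -- orthogonally to `g₀` and solved there.
  nearest : (z : Vector Carrier D) (g : Vector (Vector Carrier D) m) → ∃ λ r → Opt z g r × ∃ (Rep z g r)
  nearest {m = ℕ.zero} z g = z , opt (λ ()) refl , (λ ()) , rep (λ ()) (λ e → sym (+-identityˡ (z e)))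
  nearest {D} {m = ℕ.suc m} z g with nearest z (g ∘ suc)
  ... | r′ , opt gs∙r′≤0 zr′≈r′r′ , a′ , rep 0≤a′ eq′ with g zero ∙ r′ ≤? 0#
  ... | yes g₀∙r′≤0 = r′ , opt (λ { zero → g₀∙r′≤0 ; (suc i) → gs∙r′≤0 i }) zr′≈r′r′
                    , 0# ∷ a′ , rep (λ { zero → ≤-refl ; (suc i) → 0≤a′ i })
                                    (λ e → trans (eq′ e) (+-congʳ (sym (trans (+-congʳ (zeroˡ _)) (+-identityˡ _)))))
  ... | no g₀∙r′≰0 = r , opt nonpos zr≈rr , b ∷ a , rep nonneg eq
    where
    g₀ = g zero

    0<g₀∙r′ : 0# < g₀ ∙ r′
    0<g₀∙r′ = ≰⇒> g₀∙r′≰0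

    0<g₀∙g₀ : 0# < g₀ ∙ g₀
    0<g₀∙g₀ = ≰⇒> λ g₀g₀≤0 → <-irrefl
      (sym (sum-zero λ e → trans (*-congʳ (∙-square-zero g₀ (antisym g₀g₀≤0 (∙-square-nonneg g₀)) e)) (zeroˡ (r′ e))))
      0<g₀∙r′

    coeff : Vector Carrier D → Carrier
    coeff v = v ∙ g₀ * (g₀ ∙ g₀) ⁻¹

    proj : Vector Carrier D → Vector Carrier D
    proj v = v ⊖ coeff v ⊙ g₀

    proj∙g₀≈0 : ∀ v → proj v ∙ g₀ ≈ 0#
    proj∙g₀≈0 v = begin
      proj v ∙ g₀                                    ≈⟨ ∙-⊖ˡ v (coeff v ⊙ g₀) g₀ ⟩
      v ∙ g₀ - (coeff v ⊙ g₀) ∙ g₀                   ≈⟨ +-congˡ (-‿cong (∙-⊙ˡ (coeff v) g₀ g₀)) ⟩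
      v ∙ g₀ - v ∙ g₀ * (g₀ ∙ g₀) ⁻¹ * g₀ ∙ g₀
        ≈⟨ solve 3 (λ x y i → x :- x :* i :* y := x :- x :* (y :* i)) refl _ _ _ ⟩
      v ∙ g₀ - v ∙ g₀ * (g₀ ∙ g₀ * (g₀ ∙ g₀) ⁻¹)
        ≈⟨ +-congˡ (-‿cong (trans (*-congˡ (*-inverseʳ 0<g₀∙g₀)) (*-identityʳ _))) ⟩
      v ∙ g₀ - v ∙ g₀                                ≈⟨ -‿inverseʳ _ ⟩
      0#                                             ∎

    IH = nearest (proj z) (λ i → proj (g (suc i)))
    r = proj₁ IH
    a = proj₁ (proj₂ (proj₂ IH))
    open Opt (proj₁ (proj₂ IH)) renaming (nonpos to proj∙r≤0; orthogonal to proj-z∙r≈r∙r)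
    open Rep (proj₂ (proj₂ (proj₂ IH))) renaming (nonneg to 0≤a; decomp to proj-decomp)

    r∙g₀≈0 : r ∙ g₀ ≈ 0#
    r∙g₀≈0 = begin
      r ∙ g₀
        ≈⟨ +-identityˡ _ ⟨
      0# + r ∙ g₀
        ≈⟨ +-congʳ (sum-zero λ i → trans (*-congˡ (proj∙g₀≈0 (g (suc i)))) (zeroʳ (a i))) ⟨
      sum (λ i → a i * proj (g (suc i)) ∙ g₀) + r ∙ g₀
        ≈⟨ decomp-∙ (λ i → proj (g (suc i))) a proj-decomp g₀ ⟨
      proj z ∙ g₀
        ≈⟨ proj∙g₀≈0 z ⟩
      0#
        ∎

    proj∙r : ∀ v → proj v ∙ r ≈ v ∙ r
    proj∙r v = begin
      proj v ∙ r                        ≈⟨ ∙-⊖ˡ v (coeff v ⊙ g₀) r ⟩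
      v ∙ r - (coeff v ⊙ g₀) ∙ r        ≈⟨ +-congˡ (-‿cong (∙-⊙ˡ (coeff v) g₀ r)) ⟩
      v ∙ r - coeff v * g₀ ∙ r          ≈⟨ +-congˡ (-‿cong (trans (*-congˡ (trans (∙-comm g₀ r) r∙g₀≈0)) (zeroʳ _))) ⟩
      v ∙ r - 0#                        ≈⟨ trans (+-congˡ -0#≈0#) (+-identityʳ _) ⟩
      v ∙ r                             ∎

    zr≈rr : z ∙ r ≈ r ∙ r
    zr≈rr = trans (sym (proj∙r z)) proj-z∙r≈r∙r

    nonpos : ∀ i → g i ∙ r ≤ 0#
    nonpos zero    = ≈⇒≤ (trans (∙-comm g₀ r) r∙g₀≈0)
    nonpos (suc i) = ≤-respˡ (proj∙r (g (suc i))) (proj∙r≤0 i)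

    -- The coefficient of `g₀` restores the components along `g₀` that projection removed from `z`
    -- and from the other generators.
    b : Carrier
    b = coeff z - sum λ i → a i * coeff (g (suc i))

    eq : ∀ e → z e ≈ lin (b ∷ a) g e + r e
    eq e = begin
      z e
        ≈⟨ solve 2 (λ z p → z := (z :- p) :+ p) refl (z e) (coeff z * g₀ e) ⟩
      proj z e + coeff z * g₀ e
        ≈⟨ +-congʳ (proj-decomp e) ⟩
      lin a (λ i → proj (g (suc i))) e + r e + coeff z * g₀ e
        ≈⟨ +-congʳ (+-congʳ (trans (sum-cong {m} λ i → solve 4 (λ a g k g₀ → a :* (g :- k :* g₀) := a :* g :+ :- (a :* k :* g₀)) refl
                                                      (a i) (g (suc i) e) (coeff (g (suc i))) (g₀ e))
                                   (trans (∑-distrib-+ {m} _ _)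
                                          (+-congˡ (trans (sum-neg {m} _) (-‿cong (sym (*-distribʳ-sum {m} (g₀ e) _)))))))) ⟩
      (lin a (g ∘ suc) e - sum (λ i → a i * coeff (g (suc i))) * g₀ e) + r e + coeff z * g₀ e
        ≈⟨ solve 5 (λ l s g₀ r k → (l :- s :* g₀) :+ r :+ k :* g₀ := ((k :- s) :* g₀ :+ l) :+ r) refl _ _ _ _ _ ⟩
      lin (b ∷ a) g e + r e
        ∎

    -- b (g₀ ∙ r′) = |r - r′|² - S₁ - S₂, where both sums are nonpositive.
    0≤b : 0# ≤ b
    0≤b = *-cancelʳ-nonneg 0<g₀∙r′ (≤-respʳ (begin
        (r ⊖ r′) ∙ (r ⊖ r′) + (- S₁ + - S₂)
          ≈⟨ +-congʳ (∙-square-⊖ r r′) ⟩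
        r ∙ r - r ∙ r′ - r ∙ r′ + r′ ∙ r′ + (- S₁ + - S₂)
          ≈⟨ +-congʳ (+-cong (+-congʳ (+-congʳ (trans (sym zr≈rr) (decomp-∙ (g ∘ suc) a′ eq′ r))))
                             (trans (sym zr′≈r′r′) (decomp-∙ g (b ∷ a) eq r′))) ⟩
        S₂ + r′ ∙ r - r ∙ r′ - r ∙ r′ + (b * g₀ ∙ r′ + S₁ + r ∙ r′) + (- S₁ + - S₂)
          ≈⟨ +-congʳ (+-congʳ (+-congʳ (+-congʳ (+-congˡ (∙-comm r′ r))))) ⟩
        S₂ + r ∙ r′ - r ∙ r′ - r ∙ r′ + (b * g₀ ∙ r′ + S₁ + r ∙ r′) + (- S₁ + - S₂)
          ≈⟨ solve 4 (λ s t d x → t :+ d :- d :- d :+ (x :+ s :+ d) :+ (:- s :+ :- t) := x) refl S₁ S₂ (r ∙ r′) (b * g₀ ∙ r′) ⟩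
        b * g₀ ∙ r′
          ∎)
      (+-nonneg (∙-square-nonneg (r ⊖ r′)) (+-nonneg (x≤0⇒0≤-x S₁≤0) (x≤0⇒0≤-x S₂≤0))))
      where
      S₁ = sum λ i → a i * g (suc i) ∙ r′
      S₂ = sum λ i → a′ i * g (suc i) ∙ r
      S₁≤0 : S₁ ≤ 0#
      S₁≤0 = weighted-nonpos 0≤a gs∙r′≤0
      S₂≤0 : S₂ ≤ 0#
      S₂≤0 = weighted-nonpos 0≤a′ (nonpos ∘ suc)

    nonneg : ∀ i → 0# ≤ (b ∷ a) i
    nonneg zero    = 0≤b
    nonneg (suc i) = 0≤a i

-- Representations of the nearest point and their polytope.

module Representations {ℓ ℓ₁ ℓ₂} (ℝ : CompleteOrderedField ℓ ℓ₁ ℓ₂) where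

  open OrderedField ℝ
  open LinearAlgebra ℝ
  open ≈-Reasoning

  private
    variable
      D m n : ℕ

  δ : Fin n → Fin n → Carrier
  δ i j = if does (i Fin.≟ j) then 1# else 0#

  sum-δ : (i : Fin n) (f : Vector Carrier n) → sum (λ j → f j * δ i j) ≈ f i
  sum-δ zero    f = trans (+-cong (*-identityʳ _) (sum-zero λ j → zeroʳ (f (suc j)))) (+-identityʳ _)
  sum-δ (suc i) f = trans (+-congʳ (zeroʳ (f zero))) (trans (+-identityˡ _) (sum-δ i (f ∘ suc)))

  -- The order of the field is not well-founded, but its pullback to a finite index set is.
  value-wellFounded : (f : Fin n → Carrier) → WellFounded (λ i j → f i < f j)
  value-wellFounded f = spo-wellFounded record
    { isEquivalence = ≡.isEquivalence
    ; irrefl        = λ { ≡.refl → <-irrefl refl }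
    ; trans         = <-trans
    ; <-resp-≈      = (λ { ≡.refl x → x }) , (λ { ≡.refl x → x })
    }

  -- Lower envelopes of finitely many lines.

  module Envelope {q} {Q : Fin n → Set q} (Q? : ∀ i → Dec (Q i)) (α β : Vector Carrier n) where

    line : Fin n → Carrier → Carrier
    line i t = α i + t * β i

    Lowest : Carrier → Fin n → Set _
    Lowest t i = Q i × (∀ j → Q j → line i t ≤ line j t)

    Meet : Rel (Fin n) _
    Meet i j = ∃ λ t → 0# ≤ t × t ≤ 1# × Lowest t i × Lowest t j

    private
      crossing : Fin n → Fin n → Carrier
      crossing i l = (α l - α i) * (β i - β l) ⁻¹

      gap : ∀ {i l} t → β l < β i → line i t + (crossing i l - t) * (β i - β l) ≈ line l t
      gap {i} {l} t βl<βi = begin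
        α i + t * β i + (crossing i l - t) * (β i - β l)
          ≈⟨ solve 5 (λ a b b′ x t → a :+ t :* b :+ (x :- t) :* (b :- b′) := a :+ t :* b′ :+ x :* (b :- b′)) refl
                   (α i) (β i) (β l) (crossing i l) t ⟩
        α i + t * β l + (α l - α i) * (β i - β l) ⁻¹ * (β i - β l)
          ≈⟨ +-congˡ (trans (*-assoc _ _ _) (*-congˡ (trans (*-comm _ _) (*-inverseʳ (x<y⇒0<y-x βl<βi))))) ⟩
        α i + t * β l + (α l - α i) * 1#
          ≈⟨ solve 3 (λ a a′ x → a :+ x :+ (a′ :- a) :* con (1 , 0) := a′ :+ x) refl (α i) (α l) (t * β l) ⟩
        line l t
          ∎

      advance : ∀ i t₀ t → line i t ≈ line i t₀ + (t - t₀) * β i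
      advance i t₀ t = solve 4 (λ a b t t₀ → a :+ t :* b := a :+ t₀ :* b :+ (t :- t₀) :* b) refl (α i) (β i) t t₀

      -- To the right of `t₀`, a line of at least the slope of `i` cannot pass below line `i`, and a
      -- line of smaller slope does so only beyond its crossing.
      stays-lowest : ∀ {i t₀ t} → Lowest t₀ i → t₀ ≤ t → (∀ l → Q l × β l < β i → t ≤ crossing i l) → Lowest t i
      stays-lowest {i} {t₀} {t} (Qi , low) t₀≤t before = Qi , λ l Ql → lower l Ql (β l <? β i)
        where
        lower : ∀ l → Q l → Dec (β l < β i) → line i t ≤ line l t
        lower l Ql (yes βl<βi) = ≤-step (*-nonneg (x≤y⇒0≤y-x (before l (Ql , βl<βi))) (<⇒≤ (x<y⇒0<y-x βl<βi))) (gap t βl<βi)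
        lower l Ql (no βl≮βi) = ≤-step (+-nonneg (x≤y⇒0≤y-x (low l Ql)) (*-nonneg (x≤y⇒0≤y-x t₀≤t) (x≤y⇒0≤y-x (≮⇒≥ βl≮βi))))
          (begin
            line i t + ((line l t₀ - line i t₀) + s * (β l - β i))              ≈⟨ +-congʳ (advance i t₀ t) ⟩
            line i t₀ + s * β i + ((line l t₀ - line i t₀) + s * (β l - β i))   ≈⟨ +-congˡ (+-congˡ (distribˡ s _ _)) ⟩
            line i t₀ + s * β i + ((line l t₀ - line i t₀) + (s * β l + s * - β i))
              ≈⟨ +-congˡ (+-congˡ (+-congˡ (sym (-‿distribʳ-* s (β i))))) ⟩
            line i t₀ + s * β i + ((line l t₀ - line i t₀) + (s * β l - s * β i))
              ≈⟨ solve 4 (λ x y p q → x :+ p :+ ((y :- x) :+ (q :- p)) := y :+ q) refl _ _ _ _ ⟩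
            line l t₀ + s * β l                                                ≈⟨ advance l t₀ t ⟨
            line l t                                                           ∎)
          where s = t - t₀

    -- Along the lower envelope the slopes decrease.
    walk : ∀ {i j t₀} → Acc (λ k l → β k < β l) i → 0# ≤ t₀ → t₀ ≤ 1# → Lowest t₀ i → Lowest 1# j → Star Meet i j
    walk {i} {j} {t₀} (acc rec) 0≤t₀ t₀≤1 low end with Fin.any? (λ l → Q? l ×-dec (β l <? β i))
    ... | no none = (1# , <⇒≤ 0<1 , ≤-refl , stays-lowest low t₀≤1 (λ l Ql → contradiction (l , Ql) none) , end) ◅ ε
    -- The envelope turns at the first crossing with a line of smaller slope. If that lies beyond 1,
    -- line `i` is still lowest at 1 and meets line `j` there.
    ... | yes some with argmin (λ l → Q? l ×-dec (β l <? β i)) (crossing i) some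
    ... | l , (Ql , βl<βi) , first with crossing i l ≤? 1#
    ... | no τ≰1 = (1# , <⇒≤ 0<1 , ≤-refl , stays-lowest low t₀≤1 (λ k Qk → ≤-trans (<⇒≤ (≰⇒> τ≰1)) (first k Qk)) , end) ◅ ε
    ... | yes τ≤1 = (τ , 0≤τ , τ≤1 , lowᵢ , lowₗ) ◅ walk (rec βl<βi) 0≤τ τ≤1 lowₗ end
      where
      τ = crossing i l
      t₀≤τ : t₀ ≤ τ
      t₀≤τ = ≤-step (*-cancelʳ-nonneg (x<y⇒0<y-x βl<βi) (≤-respʳ
               (trans (+-congʳ (sym (gap t₀ βl<βi))) (solve 2 (λ x y → x :+ y :- x := y) refl _ _)) (x≤y⇒0≤y-x (proj₂ low l Ql))))
               (solve 2 (λ t τ → t :+ (τ :- t) := τ) refl t₀ τ)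
      0≤τ : 0# ≤ τ
      0≤τ = ≤-trans 0≤t₀ t₀≤τ
      lowᵢ : Lowest τ i
      lowᵢ = stays-lowest low t₀≤τ first
      lineᵢ≈lineₗ : line i τ ≈ line l τ
      lineᵢ≈lineₗ = trans (sym (trans (+-congˡ (trans (*-congʳ (-‿inverseʳ τ)) (zeroˡ _))) (+-identityʳ _))) (gap τ βl<βi)
      lowₗ : Lowest τ l
      lowₗ = Ql , λ k Qk → ≤-respˡ lineᵢ≈lineₗ (proj₂ lowᵢ k Qk)

  -- Segments, kernel directions and the boundary of the polytope.

  between : Vector Carrier m → Vector Carrier m → Carrier → Vector Carrier m
  between a b t i = a i + t * (b i - a i)

  module _ {z : Vector Carrier D} {g : Vector (Vector Carrier D) m} {r : Vector Carrier D} where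

    rep-shift : ∀ {a k} u → Rep z g r a → (∀ e → lin k g e ≈ 0#) → (∀ i → 0# ≤ a i + u * k i) →
                Rep z g r (λ i → a i + u * k i)
    rep-shift {a} {k} u (rep _ eq) dep 0≤a′ = rep 0≤a′ λ e → trans (eq e) (+-congʳ (sym (begin
      lin (λ i → a i + u * k i) g e    ≈⟨ lin-+ a (u ⊙ k) g e ⟩
      lin a g e + lin (u ⊙ k) g e      ≈⟨ +-congˡ (trans (lin-⊙ u k g e) (trans (*-congˡ (dep e)) (zeroʳ u))) ⟩
      lin a g e + 0#                   ≈⟨ +-identityʳ _ ⟩
      lin a g e                        ∎)))

    rep-between : ∀ {a b t} → Rep z g r a → Rep z g r b → 0# ≤ t → t ≤ 1# → Rep z g r (between a b t)
    rep-between {a} {b} {t} ra rb 0≤t t≤1 = rep-shift t ra dep nonneg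
      where
      open Rep ra renaming (nonneg to 0≤a; decomp to eqa)
      open Rep rb renaming (nonneg to 0≤b; decomp to eqb)
      dep : ∀ e → lin (λ i → b i - a i) g e ≈ 0#
      dep e = begin
        lin (λ i → b i - a i) g e
          ≈⟨ sum-cong {m} (λ i → solve 3 (λ b a g → (b :- a) :* g := b :* g :+ :- (a :* g)) refl (b i) (a i) (g i e)) ⟩
        sum (λ i → b i * g i e + - (a i * g i e)) ≈⟨ trans (∑-distrib-+ {m} _ _) (+-congˡ (sum-neg {m} _)) ⟩
        lin b g e - lin a g e
          ≈⟨ solve 3 (λ x y r → x :- y := (x :+ r) :- (y :+ r)) refl (lin b g e) (lin a g e) (r e) ⟩
        (lin b g e + r e) - (lin a g e + r e)    ≈⟨ +-cong (sym (eqb e)) (-‿cong (sym (eqa e))) ⟩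
        z e - z e                                ≈⟨ -‿inverseʳ _ ⟩
        0#                                       ∎
      nonneg : ∀ i → 0# ≤ between a b t i
      nonneg i = ≤-respʳ (solve 3 (λ a b t → (con (1 , 0) :- t) :* a :+ t :* b := a :+ t :* (b :- a)) refl (a i) (b i) t)
        (+-nonneg (*-nonneg (x≤y⇒0≤y-x t≤1) (0≤a i)) (*-nonneg 0≤t (0≤b i)))

  -- Appending r to the vectors gains one dimension: its coefficient in a dependency of
  -- vectors orthogonal to r vanishes.  The extra coordinate δ x forces κ x = 0.
  tight-dependency : {g : Vector (Vector Carrier D) m} {r : Vector Carrier D} → D ℕ.< m → 0# < r ∙ r →
                     ∀ x → (∀ i → i ≢ x → g i ∙ r ≈ 0#) →
                     ∃ λ κ → κ x ≈ 0# × Dependency g κ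
  tight-dependency {D} {m} {g} {r} D<m 0<rr x tight with dependency (ℕ.s≤s D<m) G
    where
    G : Vector (Vector Carrier (ℕ.suc D)) (ℕ.suc m)
    G = (0# ∷ r) ∷ λ i → δ x i ∷ g i
  ... | k , (i , ki≉0) , dep = κ , κx≈0 , nonzero i ki≉0 , λ e → begin
      lin κ g e                   ≈⟨ trans (+-congʳ (trans (*-congʳ k₀≈0) (zeroˡ (r e)))) (+-identityˡ _) ⟨
      k zero * r e + lin κ g e    ≈⟨ dep (suc e) ⟩
      0#                          ∎
    where
    κ = k ∘ suc
    κx≈0 : κ x ≈ 0#
    κx≈0 = trans (sym (sum-δ x κ)) (trans (sym (trans (+-congʳ (zeroʳ (k zero))) (+-identityˡ _))) (dep zero))
    vanish : ∀ i → κ i * g i ∙ r ≈ 0#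
    vanish i with i Fin.≟ x
    ... | yes ≡.refl = trans (*-congʳ κx≈0) (zeroˡ _)
    ... | no i≢x     = trans (*-congˡ (tight i i≢x)) (zeroʳ _)
    k₀≈0 : k zero ≈ 0#
    k₀≈0 = *-zeroˡ-pos 0<rr (begin
      k zero * r ∙ r                                  ≈⟨ ∙-⊙ˡ (k zero) r r ⟨
      (k zero ⊙ r) ∙ r                                ≈⟨ trans (+-congˡ (sum-zero vanish)) (+-identityʳ _) ⟨
      (k zero ⊙ r) ∙ r + sum (λ i → κ i * g i ∙ r)    ≈⟨ +-congˡ (∙-lin κ g r) ⟨
      (k zero ⊙ r) ∙ r + lin κ g ∙ r                  ≈⟨ ∙-+ˡ (k zero ⊙ r) (lin κ g) r ⟨
      (λ e → k zero * r e + lin κ g e) ∙ r            ≈⟨ sum-zero (λ e → trans (*-congʳ (dep (suc e))) (zeroˡ (r e))) ⟩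
      0#                                              ∎)
    nonzero : ∀ i → ¬ (k i ≈ 0#) → ∃ λ j → ¬ (κ j ≈ 0#)
    nonzero zero    k₀≉0 = contradiction k₀≈0 k₀≉0
    nonzero (suc i) ki≉0 = i , ki≉0

  neg-dependency : {g : Vector (Vector Carrier D) m} {κ : Vector Carrier m} →
                   (∀ e → lin κ g e ≈ 0#) → ∀ e → lin (λ i → - κ i) g e ≈ 0#
  neg-dependency {m = m} {g} {κ} dep e = trans (sum-cong λ j → sym (-‿distribˡ-* (κ j) (g j e)))
    (trans (sum-neg {m} _) (trans (-‿cong (dep e)) -0#≈0#))

  -- The sign of `κ` is free. A negative entry makes the polytope end in direction `κ`; the
  -- condition at `w` keeps that coordinate from growing.
  oriented : {g : Vector (Vector Carrier D) m} {κ : Vector Carrier m} → Dependency g κ → ∀ x w → κ x ≈ 0# →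
             ∃ λ κ′ → κ′ x ≈ 0# × κ′ w ≤ 0# × (∃ λ l → κ′ l < 0#) × (∀ e → lin κ′ g e ≈ 0#)
  oriented {g = g} {κ} ((i , κi≉0) , dep) x w κx≈0 with compare (κ w) 0# | compare (κ i) 0#
  ... | tri< κw<0 _ _ | _             = κ , κx≈0 , <⇒≤ κw<0 , (w , κw<0) , dep
  ... | tri≈ _ κw≈0 _ | tri< κi<0 _ _ = κ , κx≈0 , ≈⇒≤ κw≈0 , (i , κi<0) , dep
  ... | tri≈ _ _ _    | tri≈ _ κi≈0 _ = contradiction κi≈0 κi≉0
  ... | tri≈ _ κw≈0 _ | tri> _ _ 0<κi = (λ j → - κ j) , trans (-‿cong κx≈0) -0#≈0# , ≈⇒≤ (trans (-‿cong κw≈0) -0#≈0#)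
                                      , (i , 0<x⇒-x<0 0<κi) , neg-dependency {g = g} dep
  ... | tri> _ _ 0<κw | _             = (λ j → - κ j) , trans (-‿cong κx≈0) -0#≈0# , <⇒≤ (0<x⇒-x<0 0<κw)
                                      , (w , 0<x⇒-x<0 0<κw) , neg-dependency {g = g} dep

  tight-kernel : {g : Vector (Vector Carrier D) m} {r : Vector Carrier D} → D ℕ.< m → 0# < r ∙ r → ∀ x w →
                 (∀ i → i ≢ x → g i ∙ r ≈ 0#) →
                 ∃ λ κ → κ x ≈ 0# × κ w ≤ 0# × (∃ λ l → κ l < 0#) × (∀ e → lin κ g e ≈ 0#)
  tight-kernel {g = g} D<m 0<rr x w tight =
    let κ , κx≈0 , dep = tight-dependency D<m 0<rr x tight in oriented {g = g} dep x w κx≈0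

  module Ratio (κ : Vector Carrier m) where

    -- The ratio test of linear programming: moving from `A` along `κ`, a decreasing coordinate `i`
    -- reaches zero at step length `A i * μ i`.
    μ : Vector Carrier m
    μ i = (- κ i) ⁻¹

    vanishes : ∀ {A i} → κ i < 0# → A + A * μ i * κ i ≈ 0#
    vanishes {A} {i} κi<0 = begin
      A + A * μ i * κ i         ≈⟨ solve 3 (λ a μ k → a :+ a :* μ :* k := a :- a :* (:- k :* μ)) refl A (μ i) (κ i) ⟩
      A - A * (- κ i * μ i)     ≈⟨ +-congˡ (-‿cong (trans (*-congˡ (*-inverseʳ (x<0⇒0<-x κi<0))) (*-identityʳ A))) ⟩
      A - A                     ≈⟨ -‿inverseʳ A ⟩
      0#                        ∎

    μ-pos : ∀ {i} → κ i < 0# → 0# < μ i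
    μ-pos κi<0 = ⁻¹-pos (x<0⇒0<-x κi<0)

    feasible : {A : Vector Carrier m} {u : Carrier} → (∀ i → 0# ≤ A i) → 0# ≤ u →
               (∀ i → κ i < 0# → u ≤ A i * μ i) → ∀ i → 0# ≤ A i + u * κ i
    feasible {A} {u} 0≤A 0≤u bound i with κ i <? 0#
    ... | no κi≮0  = +-nonneg (0≤A i) (*-nonneg 0≤u (≮⇒≥ κi≮0))
    ... | yes κi<0 = ≤-respʳ (begin
        (A i * μ i - u) * - κ i
          ≈⟨ solve 4 (λ a μ k u → (a :* μ :- u) :* (:- k) := (a :+ u :* k) :- (a :+ a :* μ :* k)) refl (A i) (μ i) (κ i) u ⟩
        (A i + u * κ i) - (A i + A i * μ i * κ i) ≈⟨ +-congˡ (trans (-‿cong (vanishes κi<0)) -0#≈0#) ⟩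
        A i + u * κ i + 0#                       ≈⟨ +-identityʳ _ ⟩
        A i + u * κ i                            ∎)
      (*-nonneg (x≤y⇒0≤y-x (bound i κi<0)) (<⇒≤ (x<0⇒0<-x κi<0)))

  module _ {z : Vector Carrier D} {g : Vector (Vector Carrier D) m} {r : Vector Carrier D} where

    -- The smallest ratio is the longest feasible step along `κ`, and its index is the coordinate
    -- that vanishes.
    rep-to-boundary : ∀ {a κ} → Rep z g r a → (∀ e → lin κ g e ≈ 0#) → (∃ λ l → κ l < 0#) →
                      ∃ λ l → κ l < 0# × ∃ λ b → Rep z g r b × b l ≈ 0#
    rep-to-boundary {a} {κ} ra dep some-neg with argmin (λ i → κ i <? 0#) (λ i → a i * Ratio.μ κ i) some-neg
    ... | l , κl<0 , least = l , κl<0 , (λ i → a i + u * κ i) , rep-shift u ra dep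
            (feasible 0≤a (*-nonneg (0≤a l) (<⇒≤ (μ-pos κl<0))) least) , vanishes κl<0
      where
      open Ratio κ
      open Rep ra renaming (nonneg to 0≤a)
      u = a l * μ l

    Joint : Rel (Fin m) _
    Joint i j = ∃ λ a → Rep z g r a × a i ≈ 0# × a j ≈ 0#

    -- The points of the planar slice a + t (b - a) + u κ of the polytope of representations on
    -- its upper boundary have a vanishing coordinate; neighbouring boundary edges meet in a
    -- representation in which both coordinates vanish.
    slice-connected : ∀ {a b κ y y′} → Rep z g r a → a y ≈ 0# → Rep z g r b → b y′ ≈ 0# →
                      (∀ e → lin κ g e ≈ 0#) → (∃ λ l → κ l < 0#) → κ y ≈ 0# → κ y′ ≤ 0# → Star Joint y y′
    slice-connected {a} {b} {κ} {y} {y′} ra ay≈0 rb by′≈0 dep some-neg κy≈0 κy′≤0 = joined (least 0#) (least 1#)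
      where
      open Ratio κ

      -- The height in direction `κ` at which coordinate `i` vanishes is affine in `t`, so the upper
      -- boundary of the slice is a lower envelope of lines.
      α β : Vector Carrier m
      α i = a i * μ i
      β i = (b i - a i) * μ i

      open Envelope (λ i → κ i <? 0#) α β

      line≈ : ∀ i t → line i t ≈ between a b t i * μ i
      line≈ i t = solve 4 (λ a b μ t → a :* μ :+ t :* ((b :- a) :* μ) := (a :+ t :* (b :- a)) :* μ) refl (a i) (b i) (μ i) t

      line-nonneg : ∀ {t i} → 0# ≤ t → t ≤ 1# → Lowest t i → 0# ≤ line i t
      line-nonneg {t} {i} 0≤t t≤1 (κi<0 , _) =
        ≤-respʳ (sym (line≈ i t)) (*-nonneg (Rep.nonneg (rep-between ra rb 0≤t t≤1) i) (<⇒≤ (μ-pos κi<0)))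

      point : Carrier → Carrier → Vector Carrier m
      point t u i = between a b t i + u * κ i

      point-rep : ∀ {t i} → 0# ≤ t → t ≤ 1# → Lowest t i → Rep z g r (point t (line i t))
      point-rep {t} {i} 0≤t t≤1 low = rep-shift (line i t) rt dep
        (feasible (Rep.nonneg rt) (line-nonneg 0≤t t≤1 low) (λ j κj<0 → ≤-respʳ (line≈ j t) (proj₂ low j κj<0)))
        where
        rt : Rep z g r (between a b t)
        rt = rep-between ra rb 0≤t t≤1

      vanishing : ∀ {t i j} → Lowest t i → Lowest t j → point t (line i t) j ≈ 0#
      vanishing {t} {i} {j} (κi<0 , lowᵢ) (κj<0 , lowⱼ) = trans
        (+-congˡ (*-congʳ (trans (antisym (lowᵢ j κj<0) (lowⱼ i κi<0)) (line≈ j t)))) (vanishes κj<0)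

      meet⇒joint : ∀ {i j} → Meet i j → Joint i j
      meet⇒joint (t , 0≤t , t≤1 , lowᵢ , lowⱼ) =
        _ , point-rep 0≤t t≤1 lowᵢ , vanishing lowᵢ lowᵢ , vanishing lowᵢ lowⱼ

      least : ∀ t → ∃ (Lowest t)
      least t = argmin (λ i → κ i <? 0#) (λ i → line i t) some-neg

      y-vanishes : ∀ u → point 0# u y ≈ 0#
      y-vanishes u = begin
        a y + 0# * (b y - a y) + u * κ y    ≈⟨ +-cong (+-cong ay≈0 (zeroˡ _)) (trans (*-congˡ κy≈0) (zeroʳ _)) ⟩
        0# + 0# + 0#                        ≈⟨ trans (+-identityʳ _) (+-identityʳ _) ⟩
        0#                                  ∎

      -- At `t = 1` this coordinate is a nonnegative multiple of `κ y′`, hence nonpositive, while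
      -- feasibility makes it nonnegative.
      y′-vanishes : ∀ {i} → Lowest 1# i → point 1# (line i 1#) y′ ≈ 0#
      y′-vanishes {i} low = antisym
        (≤-respˡ (sym reduce) (*-nonneg-nonpos (line-nonneg (<⇒≤ 0<1) ≤-refl low) κy′≤0))
        (Rep.nonneg (point-rep (<⇒≤ 0<1) ≤-refl low) y′)
        where
        reduce : point 1# (line i 1#) y′ ≈ line i 1# * κ y′
        reduce = begin
          a y′ + 1# * (b y′ - a y′) + line i 1# * κ y′
            ≈⟨ +-congʳ (solve 2 (λ a b → a :+ con (1 , 0) :* (b :- a) := b) refl (a y′) (b y′)) ⟩
          b y′ + line i 1# * κ y′                       ≈⟨ trans (+-congʳ by′≈0) (+-identityˡ _) ⟩
          line i 1# * κ y′                              ∎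

      joined : ∃ (Lowest 0#) → ∃ (Lowest 1#) → Star Joint y y′
      joined (l₀ , low₀) (l₁ , low₁) =
        (_ , point-rep ≤-refl (<⇒≤ 0<1) low₀ , y-vanishes _ , vanishing low₀ low₀) ◅
        gmap (λ i → i) meet⇒joint (walk (value-wellFounded β l₀) ≤-refl (<⇒≤ 0<1) low₀ low₁) ◅◅
        (_ , point-rep (<⇒≤ 0<1) ≤-refl low₁ , vanishing low₁ low₁ , y′-vanishes low₁) ◅ ε

    module _ (D<m : D ℕ.< m) (0<rr : 0# < r ∙ r) (optimal : Opt z g r) where

      -- If no coordinate other than `x` vanishes, slackness makes all vectors but `g x` orthogonal
      -- to `r`. A dependency with `κ x ≈ 0#` then leads to the boundary, and the vanishing index
      -- has `κ l < 0#`, so it differs from `x`.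
      carathéodory : ∀ {a} → Rep z g r a → ∀ x → ∃ λ y → y ≢ x × ∃ λ b → Rep z g r b × b y ≈ 0#
      carathéodory {a} ra x with Fin.any? (λ i → ¬? (i Fin.≟ x) ×-dec (a i ≟ 0#))
      ... | yes (y , y≢x , ay≈0) = y , y≢x , a , ra , ay≈0
      ... | no none = conclude (tight-kernel D<m 0<rr x x tight)
        where
        tight : ∀ i → i ≢ x → g i ∙ r ≈ 0#
        tight i i≢x = *-zeroˡ-pos (≰⇒> λ ai≤0 → none (i , i≢x , antisym ai≤0 (Rep.nonneg ra i)))
                                  (trans (*-comm _ _) (complementary optimal ra i))
        conclude : (∃ λ κ → κ x ≈ 0# × κ x ≤ 0# × (∃ λ l → κ l < 0#) × (∀ e → lin κ g e ≈ 0#)) →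
                   ∃ λ y → y ≢ x × ∃ λ b → Rep z g r b × b y ≈ 0#
        conclude (κ , κx≈0 , _ , some-neg , dep) =
          let l , κl<0 , boundary = rep-to-boundary ra dep some-neg
          in l , (λ l≡x → <-irrefl (≡.subst (λ i → κ i ≈ 0#) (≡.sym l≡x) κx≈0) κl<0) , boundary

      -- A vector off the hyperplane orthogonal to `r` has coefficient zero in every representation,
      -- so its index joins `y` to `y′`. If all vectors lie on the hyperplane, a planar slice of the
      -- polytope joins them.
      redundant-connected : ∀ {a b y y′} → Rep z g r a → a y ≈ 0# → Rep z g r b → b y′ ≈ 0# → Star Joint y y′
      redundant-connected {a} {b} {y} {y′} ra ay≈0 rb by′≈0 with Fin.any? (λ i → ¬? (g i ∙ r ≟ 0#))
      ... | yes (i , gi∙r≉0) = (a , ra , ay≈0 , slack ra) ◅ (b , rb , slack rb , by′≈0) ◅ ε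
        where
        slack : ∀ {a} → Rep z g r a → a i ≈ 0#
        slack {a} ra = decidable-stable (a i ≟ 0#) λ ai≉0 → gi∙r≉0
          (*-zeroˡ-pos (≰⇒> λ ai≤0 → ai≉0 (antisym ai≤0 (Rep.nonneg ra i))) (trans (*-comm _ _) (complementary optimal ra i)))
      ... | no allTight =
        let tight i i≢y = decidable-stable (g i ∙ r ≟ 0#) λ gi∙r≉0 → allTight (i , gi∙r≉0)
            κ , κy≈0 , κy′≤0 , some-neg , dep = tight-kernel D<m 0<rr y y′ tight
        in slice-connected ra ay≈0 rb by′≈0 dep some-neg κy≈0 κy′≤0

-- Squared distances to cones and their comparison.

module ColourfulChoices {ℓ ℓ₁ ℓ₂} (ℝ : CompleteOrderedField ℓ ℓ₁ ℓ₂) where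

  open OrderedField ℝ
  open LinearAlgebra ℝ
  open Representations ℝ

  module Distance {D m : ℕ} (z : Vector Carrier D) where

    private
      variable
        g h : Vector (Vector Carrier D) m
        r r′ : Vector Carrier D
        a b : Vector Carrier m

    abstract
      -- The squared distance from `z` to the cone of `g`; later arguments see it only through
      -- `residual`.
      ρ : Vector (Vector Carrier D) m → Carrier
      ρ g = let r , _ = nearest z g in r ∙ r

      residual : ∀ g → ∃ λ r → Opt z g r × ∃ (Rep z g r) × ρ g ≈ r ∙ r
      residual g = let r , o , ∃a = nearest z g in r , o , ∃a , refl

    rep-transfer : Rep z g r a → (∀ i → 0# ≤ b i) → (∀ i e → a i * g i e ≈ b i * h i e) → Rep z h r b
    rep-transfer ra 0≤b ag≈bh = rep 0≤b λ e → trans (Rep.decomp ra e) (+-congʳ (sum-cong λ i → ag≈bh i e))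

    ρ-min : Rep z g r a → ρ g ≤ r ∙ r
    ρ-min {g} {r} ra = let r₀ , o , _ , ρ≈ = residual g in
      ≤-respˡ (sym ρ≈) (≤-trans (≤-step (∙-square-nonneg (r ⊖ r₀)) (+-comm _ _)) (opt-≤ o ra))

    -- Weak duality: the conditions of `Opt` bound the distance from below even when `r` is not
    -- known to leave a point of the cone.
    ρ-opt : Opt z g r → r ∙ r ≤ ρ g
    ρ-opt {g} {r} o = let r₀ , _ , (_ , rep₀) , ρ≈ = residual g in
      ≤-respʳ (sym ρ≈) (≤-trans (≤-step (∙-square-nonneg (r₀ ⊖ r)) (+-comm _ _)) (opt-≤ o rep₀))

    opt-unique : Opt z g r → Rep z g r′ a → r′ ∙ r′ ≤ r ∙ r → ∀ e → r′ e ≈ r e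
    opt-unique {g} {r} {r′} o rep′ r′r′≤rr e = x-y≈0⇒x≈y (∙-square-zero (r′ ⊖ r) (antisym d≤0 (∙-square-nonneg (r′ ⊖ r))) e)
      where
      d≤0 : (r′ ⊖ r) ∙ (r′ ⊖ r) ≤ 0#
      d≤0 = ≤-respˡ (solve 2 (λ d x → d :+ x :- x := d) refl _ _)
              (≤-respʳ (-‿inverseʳ (r ∙ r)) (+-monoʳ-≤ (- (r ∙ r)) (≤-trans (opt-≤ o rep′) r′r′≤rr)))

    -- If the distance did not drop, uniqueness would make `r` the optimal residual, whose inner
    -- product with every generator is nonpositive.
    ρ-strict : Rep z g r a → ∀ y → 0# < g y ∙ r → ρ g < r ∙ r
    ρ-strict {g} {r} ra y 0<gy∙r = ≰⇒> λ rr≤ρ → let r₀ , o , _ , ρ≈ = residual g in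
      <⇒≱ (<-respʳ (∙-congˡ (g y) (opt-unique o ra (≤-respʳ ρ≈ rr≤ρ))) 0<gy∙r) (Opt.nonpos o y)

    ρ-mono : (∀ {r a} → Rep z g r a → ∃ (Rep z h r)) → ρ h ≤ ρ g
    ρ-mono {g} g⇒h = let r , _ , (_ , ra) , ρ≈ = residual g in ≤-respʳ (sym ρ≈) (ρ-min (proj₂ (g⇒h ra)))

  -- Colourful choices and changes at one index.

  module Colourful {D m k : ℕ} (D<m : D ℕ.< m) (z : Vector Carrier D) (0<zz : 0# < z ∙ z)
                   (P : Fin m → Fin k → Vector Carrier D)
                   -- By Farkas' lemma this says that `z` lies in the cone of the vectors `P j c`
                   -- for each fixed `j`, as in Bárány's colourful Carathéodory theorem.
                   (escape : ∀ j {r} → 0# < z ∙ r → ∃ λ c → 0# < P j c ∙ r) where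

    open Distance {D} {m} z

    Choice : Set
    Choice = Fin m → Fin k

    infixl 9 _[_≔_]
    _[_≔_] : Choice → Fin m → Fin k → Choice
    s [ y ≔ c ] = updateAt s y (const c)

    chosen : Choice → Vector (Vector Carrier D) m
    chosen s j = P j (s j)

    -- The vector at `x` becomes zero instead of being removed, so there are still `m` generators
    -- and `D<m` applies.
    drop : Fin m → Choice → Vector (Vector Carrier D) m
    drop x s = updateAt (chosen s) x λ _ _ → 0#

    Agree : Fin m → Rel Choice _
    Agree x s t = ∀ j → j ≢ x → s j ≡ t j

    agree-sym : ∀ {x s t} → Agree x s t → Agree x t s
    agree-sym s~t j j≢x = ≡.sym (s~t j j≢x)

    agree-update : ∀ s x c → Agree x s (s [ x ≔ c ])
    agree-update s x c j j≢x = ≡.sym (updateAt-minimal j x s j≢x)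

    update-≡ : ∀ s x c → (s [ x ≔ c ]) x ≡ c
    update-≡ s x c = updateAt-updates x s

    update-agree : ∀ {x s t} y c → Agree x s t → Agree x (s [ y ≔ c ]) (t [ y ≔ c ])
    update-agree {x} {s} {t} y c s~t j j≢x with j Fin.≟ y
    ... | yes ≡.refl = ≡.trans (update-≡ s j c) (≡.sym (update-≡ t j c))
    ... | no j≢y     = ≡.trans (updateAt-minimal j y s j≢y) (≡.trans (s~t j j≢x) (≡.sym (updateAt-minimal j y t j≢y)))

    rep-agree : ∀ {s t r a} → Rep z (chosen s) r a → (∀ j → a j ≈ 0# ⊎ s j ≡ t j) → Rep z (chosen t) r a
    rep-agree {s} {t} {r} {a} ra same = rep-transfer ra (Rep.nonneg ra) λ j e → go j e (same j)
      where
      go : ∀ j e → a j ≈ 0# ⊎ s j ≡ t j → a j * P j (s j) e ≈ a j * P j (t j) e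
      go j e (inj₁ aj≈0)  = trans (*-congʳ aj≈0) (trans (zeroˡ _) (sym (trans (*-congʳ aj≈0) (zeroˡ _))))
      go j e (inj₂ sj≡tj) = reflexive (≡.cong (λ c → a j * P j c e) sj≡tj)

    rep-agree₁ : ∀ {s t r a x} → Rep z (chosen s) r a → a x ≈ 0# → Agree x s t → Rep z (chosen t) r a
    rep-agree₁ {s} {t} {a = a} {x} ra ax≈0 s~t = rep-agree ra same
      where
      same : ∀ j → a j ≈ 0# ⊎ s j ≡ t j
      same j with j Fin.≟ x
      ... | yes ≡.refl = inj₁ ax≈0
      ... | no j≢x     = inj₂ (s~t j j≢x)

    rep-drop : ∀ {s r a x} → Rep z (chosen s) r a → a x ≈ 0# → Rep z (drop x s) r a
    rep-drop {s} {r} {a} {x} ra ax≈0 = rep-transfer ra (Rep.nonneg ra) go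
      where
      go : ∀ j e → a j * chosen s j e ≈ a j * drop x s j e
      go j e with j Fin.≟ x
      ... | yes ≡.refl = trans (*-congʳ ax≈0) (trans (zeroˡ _) (sym (trans (*-congʳ ax≈0) (zeroˡ _))))
      ... | no j≢x     = reflexive (≡.cong (λ v → a j * v e) (≡.sym (updateAt-minimal j x (chosen s) j≢x)))

    zeroed : Fin m → Vector Carrier m → Vector Carrier m
    zeroed x a = updateAt a x (const 0#)

    zeroed-zero : ∀ x a {j} → a j ≈ 0# → zeroed x a j ≈ 0#
    zeroed-zero x a {j} aj≈0 with j Fin.≟ x
    ... | yes ≡.refl = reflexive (updateAt-updates j a)
    ... | no j≢x     = trans (reflexive (updateAt-minimal j x a j≢x)) aj≈0

    -- The coefficient at `x` belonged to the zero vector and is arbitrary; it must be reset to zero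
    -- before the vector chosen by `s` returns.
    rep-undrop : ∀ {s r a} x → Rep z (drop x s) r a → Rep z (chosen s) r (zeroed x a)
    rep-undrop {s} {r} {a} x ra = rep-transfer ra nonneg go
      where
      nonneg : ∀ j → 0# ≤ zeroed x a j
      nonneg j with j Fin.≟ x
      ... | yes ≡.refl = ≈⇒≤ (reflexive (≡.sym (updateAt-updates j a)))
      ... | no j≢x     = ≤-respʳ (reflexive (≡.sym (updateAt-minimal j x a j≢x))) (Rep.nonneg ra j)
      go : ∀ j e → a j * drop x s j e ≈ zeroed x a j * chosen s j e
      go j e with j Fin.≟ x
      ... | yes ≡.refl = trans (*-congˡ (reflexive (≡.cong (λ v → v e) (updateAt-updates j (chosen s)))))
                           (trans (zeroʳ _) (sym (trans (*-congʳ (reflexive (updateAt-updates j a))) (zeroˡ _))))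
      ... | no j≢x     = *-cong (reflexive (≡.sym (updateAt-minimal j x a j≢x)))
                                (reflexive (≡.cong (λ v → v e) (updateAt-minimal j x (chosen s) j≢x)))

    -- Together with `agree-sym` this shows that both ends assign the same height to a step.
    ρ-drop-agree : ∀ {x s t} → Agree x s t → ρ (drop x t) ≤ ρ (drop x s)
    ρ-drop-agree {x} s~t = ρ-mono λ {_} {a} ra →
      let zx = reflexive (updateAt-updates x a) in _ , rep-drop (rep-agree₁ (rep-undrop x ra) zx s~t) zx

    opt-drop : ∀ {x s r} → Opt z (drop x s) r → ∀ j → j ≢ x → P j (s j) ∙ r ≤ 0#
    opt-drop {x} {s} {r} o j j≢x =
      ≤-respˡ (reflexive (≡.cong (_∙ r) (updateAt-minimal j x (chosen s) j≢x))) (Opt.nonpos o j)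

    opt-undrop : ∀ {x s t r} → Agree x s t → Opt z (drop x s) r → P x (t x) ∙ r ≤ 0# → Opt z (chosen t) r
    opt-undrop {x} {s} {t} {r} s~t o Px≤0 = opt nonpos (Opt.orthogonal o)
      where
      nonpos : ∀ j → P j (t j) ∙ r ≤ 0#
      nonpos j with j Fin.≟ x
      ... | yes ≡.refl = Px≤0
      ... | no j≢x     = ≤-respˡ (reflexive (≡.cong (λ c → P j c ∙ r) (s~t j j≢x))) (opt-drop {s = s} o j j≢x)

    -- The representation uses neither `x` nor `y`, so it survives changes there; the new vector at
    -- `y` then shortens the residual while `x` stays omitted.
    below : ∀ {s t r a x y c} → Rep z (chosen s) r a → a x ≈ 0# → a y ≈ 0# → y ≢ x → 0# < P y c ∙ r →
            (∀ j → j ≢ x → j ≢ y → s j ≡ t j) → t y ≡ c → ρ (drop x t) < r ∙ r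
    below {s} {t} {r} {a} {x} {y} ra ax≈0 ay≈0 y≢x 0<Py∙r s~t ≡.refl =
      ρ-strict (rep-drop (rep-agree ra same) ax≈0) y
        (<-respʳ (reflexive (≡.cong (_∙ r) (≡.sym (updateAt-minimal y x (chosen t) y≢x)))) 0<Py∙r)
      where
      same : ∀ j → a j ≈ 0# ⊎ s j ≡ t j
      same j with j Fin.≟ x | j Fin.≟ y
      ... | yes ≡.refl | _          = inj₁ ax≈0
      ... | no _       | yes ≡.refl = inj₁ ay≈0
      ... | no j≢x     | no j≢y     = inj₂ (s~t j j≢x j≢y)

    -- Saddles and the mountain-pass argument.

    opt-escape : ∀ {g : Vector (Vector Carrier D) m} {r} → Opt z g r → 0# < r ∙ r → 0# < z ∙ r
    opt-escape o 0<rr = <-respʳ (sym (Opt.orthogonal o)) 0<rr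

    -- At the height of the step at `x`, a nearest point represented without `x` and `y`, and a
    -- value `c` at `y` that brings the cone closer to `z`.
    record Saddle (x : Fin m) (s : Choice) : Set (ℓ ⊔ ℓ₁ ⊔ ℓ₂) where
      field
        {r} : Vector Carrier D
        {a} : Vector Carrier m
        {y} : Fin m
        {c} : Fin k
        optimal : Opt z (drop x s) r
        ρ≈      : ρ (drop x s) ≈ r ∙ r
        reps    : Rep z (chosen s) r a
        ax≈0    : a x ≈ 0#
        y≢x     : y ≢ x
        ay≈0    : a y ≈ 0#
        0<Py∙r  : 0# < P y c ∙ r

    saddle : ∀ x s → 0# < ρ (drop x s) → Saddle x s
    saddle x s 0<ρ =
      let r , o , (_ , ra) , ρ≈ = residual (drop x s)
          0<rr = <-respʳ ρ≈ 0<ρ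
          y , y≢x , b , rb , by≈0 = carathéodory D<m 0<rr o ra x
          _ , 0<Py∙r = escape y (opt-escape o 0<rr)
      in record { optimal = o ; ρ≈ = ρ≈ ; reps = rep-undrop x rb ; ax≈0 = reflexive (updateAt-updates x b)
                ; y≢x = y≢x ; ay≈0 = zeroed-zero x b by≈0 ; 0<Py∙r = 0<Py∙r }

    -- The predicate `R` constrains the height of the step. A step may leave the choice unchanged.
    Edge : ∀ {p} → (Carrier → Set p) → Rel Choice _
    Edge R s t = ∃ λ x → Agree x s t × R (ρ (drop x s))

    edge<-sym : ∀ {M s t} → Edge (_< M) s t → Edge (_< M) t s
    edge<-sym (x , s~t , ρ<M) = x , agree-sym s~t , ≤-<-trans (ρ-drop-agree s~t) ρ<M

    module _ {M : Carrier} (0<M : 0# < M) where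

      -- A step of height `M` between choices below `M` is bypassed through a free index: move `y`
      -- to `c`, perform the step at `x`, move `y` back.
      low-edge-connected : ∀ {x s t} → Agree x s t → ρ (drop x s) ≤ M → ρ (chosen s) < M → ρ (chosen t) < M →
                           Star (Edge (_< M)) s t
      low-edge-connected {x} {s} {t} s~t ρ≤M ρs<M ρt<M with ρ (drop x s) <? M
      ... | yes ρ<M = (x , s~t , ρ<M) ◅ ε
      ... | no ρ≮M  = (y , agree-update s y c , <-≤-trans s<rr rr≤M) ◅ (x , update-agree y c s~t , <-≤-trans s′<rr rr≤M) ◅
                      edge<-sym (y , agree-update t y c , <-≤-trans t<rr rr≤M) ◅ ε
        where
        open Saddle (saddle x s (<-≤-trans 0<M (≮⇒≥ ρ≮M)))
        rr≤M : r ∙ r ≤ M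
        rr≤M = ≤-respˡ ρ≈ ρ≤M
        -- Were this product nonpositive, `r` would stay optimal with the vector of `u` restored at
        -- `x`, and `u` would not be below `M`. Its positivity is what lowers the two steps at `y`.
        rises : ∀ {u} → Agree x s u → ρ (chosen u) < M → 0# < P x (u x) ∙ r
        rises s~u ρu<M = ≰⇒> λ Px≤0 →
          <⇒≱ ρu<M (≤-trans (≤-respʳ ρ≈ (≮⇒≥ ρ≮M)) (ρ-opt (opt-undrop s~u optimal Px≤0)))
        s<rr : ρ (drop y s) < r ∙ r
        s<rr = below reps ay≈0 ax≈0 (≡.≢-sym y≢x) (rises (λ _ _ → ≡.refl) ρs<M) (λ _ _ _ → ≡.refl) ≡.refl
        t<rr : ρ (drop y t) < r ∙ r
        t<rr = below reps ay≈0 ax≈0 (≡.≢-sym y≢x) (rises s~t ρt<M) (λ j _ j≢x → s~t j j≢x) ≡.refl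
        s′<rr : ρ (drop x (s [ y ≔ c ])) < r ∙ r
        s′<rr = below reps ax≈0 ay≈0 y≢x 0<Py∙r (λ j _ j≢y → agree-update s y c j j≢y) (update-≡ s y c)

      -- A descent from a path vertex `s`, which may itself lie at level `M`, to a choice strictly
      -- below `M`.
      LowNeighbour : Rel Choice _
      LowNeighbour s u = ∃ λ y → Agree y s u × ρ (drop y s) ≤ M × ρ (chosen u) < M

      update-low : ∀ {s r a y c} → Rep z (chosen s) r a → a y ≈ 0# → 0# < P y c ∙ r → r ∙ r ≤ M →
                   ρ (chosen (s [ y ≔ c ])) < M
      update-low {s} {r} {a} {y} {c} ra ay≈0 0<Py∙r rr≤M = <-≤-trans
        (ρ-strict (rep-agree₁ ra ay≈0 (agree-update s y c)) y
          (<-respʳ (reflexive (≡.cong (λ c → P y c ∙ r) (≡.sym (update-≡ s y c)))) 0<Py∙r)) rr≤M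

      -- As `s` is not below `M`, restoring the vector at `y` cannot shorten the residual, which is
      -- therefore already optimal for the whole choice.
      top : ∀ {s y} → ρ (drop y s) ≤ M → M ≤ ρ (chosen s) →
            ∃ λ r → Opt z (chosen s) r × r ∙ r ≈ M × ∃ λ a → Rep z (chosen s) r a × a y ≈ 0#
      top {s} {y} ρ≤M M≤ρs =
        let r , o , (a , ra) , ρ≈ = residual (drop y s)
            ra′ = rep-undrop y ra
            rr≤M = ≤-respˡ ρ≈ ρ≤M
            Py≤0 = ≮⇒≥ λ 0<Py∙r → <⇒≱ (<-≤-trans (ρ-strict ra′ y 0<Py∙r) rr≤M) M≤ρs
        in r , opt-undrop (λ _ _ → ≡.refl) o Py≤0 , antisym rr≤M (≤-trans M≤ρs (ρ-min ra′))
           , _ , ra′ , reflexive (updateAt-updates y a)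

      -- If `s` is below `M`, both steps are bypassed through `s`. Otherwise its nearest point has
      -- representations avoiding `y` and `y′`; `redundant-connected` links these indices, and
      -- lifting `s` at each index on the way gives a path below `M`.
      lowNeighbours-connected : ∀ {s u v} → LowNeighbour s u → LowNeighbour s v → Star (Edge (_< M)) u v
      lowNeighbours-connected {s} {u} {v} (y , s~u , ρy≤M , ρu<M) (y′ , s~v , ρy′≤M , ρv<M) with ρ (chosen s) <? M
      ... | yes ρs<M = reverse edge<-sym (low-edge-connected s~u ρy≤M ρs<M ρu<M) ◅◅ low-edge-connected s~v ρy′≤M ρs<M ρv<M
      ... | no ρs≮M = peak (top ρy≤M (≮⇒≥ ρs≮M)) (top ρy′≤M (≮⇒≥ ρs≮M))
        where
        Top : Fin m → Set _
        Top y = ∃ λ r → Opt z (chosen s) r × r ∙ r ≈ M × ∃ λ a → Rep z (chosen s) r a × a y ≈ 0#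

        peak : Top y → Top y′ → Star (Edge (_< M)) u v
        peak (r , o , rr≈M , a , ra , ay≈0) (r′ , _ , r′r′≈M , b , rb , by′≈0) =
          low-edge-connected (to-lift s~u) (≤-trans (ρ-drop-agree s~u) ρy≤M) ρu<M (update-low ra ay≈0 (rise y) rr≤M) ◅◅
          kleisliStar lift joint-connected (redundant-connected D<m 0<rr o ra ay≈0 rb′ by′≈0) ◅◅
          reverse edge<-sym
            (low-edge-connected (to-lift s~v) (≤-trans (ρ-drop-agree s~v) ρy′≤M) ρv<M (update-low rb′ by′≈0 (rise y′) rr≤M))
          where
          rr≤M : r ∙ r ≤ M
          rr≤M = ≈⇒≤ rr≈M
          0<rr : 0# < r ∙ r
          0<rr = <-respʳ (sym rr≈M) 0<M
          r′≈r : ∀ e → r′ e ≈ r e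
          r′≈r = opt-unique o rb (≈⇒≤ (trans r′r′≈M (sym rr≈M)))
          rb′ : Rep z (chosen s) r b
          rb′ = rep (Rep.nonneg rb) λ e → trans (Rep.decomp rb e) (+-congˡ (r′≈r e))
          colour : Fin m → Fin k
          colour i = proj₁ (escape i (opt-escape o 0<rr))
          rise : ∀ i → 0# < P i (colour i) ∙ r
          rise i = proj₂ (escape i (opt-escape o 0<rr))
          lift : Fin m → Choice
          lift i = s [ i ≔ colour i ]
          to-lift : ∀ {i w} → Agree i s w → Agree i w (lift i)
          to-lift {i} s~w j j≢i = ≡.trans (≡.sym (s~w j j≢i)) (agree-update s i (colour i) j j≢i)
          joint-connected : ∀ {i j} → Joint {z = z} {chosen s} {r} i j → Star (Edge (_< M)) (lift i) (lift j)
          joint-connected {i} {j} (a , ra , ai≈0 , aj≈0) with i Fin.≟ j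
          ... | yes ≡.refl = ε
          -- The two lifts are joined through the choice lifted at both `i` and `j`.
          ... | no i≢j = (j , agree-update (lift i) j (colour j) , <-≤-trans lower₁ rr≤M) ◅
                         (i , update-agree j (colour j) (agree-sym (agree-update s i (colour i))) , <-≤-trans lower₂ rr≤M) ◅ ε
            where
            lower₁ : ρ (drop j (lift i)) < r ∙ r
            lower₁ = below ra aj≈0 ai≈0 i≢j (rise i) (λ l _ l≢i → agree-update s i (colour i) l l≢i) (update-≡ s i (colour i))
            lower₂ : ρ (drop i (lift i [ j ≔ colour j ])) < r ∙ r
            lower₂ = below ra ai≈0 aj≈0 (≡.≢-sym i≢j) (rise j)
              (λ l l≢i l≢j → ≡.trans (agree-update s i (colour i) l l≢i) (agree-update (lift i) j (colour j) l l≢j))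
              (update-≡ (lift i) j (colour j))

      -- An endpoint below `M` serves both sides. Otherwise one free index `y` of a saddle takes
      -- both endpoints below `M`, and the step at `x` between the results is lower too.
      lowNeighbours-linked : ∀ {s t} → Edge (_≤ M) s t →
                             ∃ λ u → ∃ λ v → LowNeighbour s u × Star (Edge (_< M)) u v × LowNeighbour t v
      lowNeighbours-linked {s} {t} (x , s~t , ρ≤M) with ρ (chosen s) <? M | ρ (chosen t) <? M
      ... | yes ρs<M | _        = s , s , (x , (λ _ _ → ≡.refl) , ρ≤M , ρs<M) , ε
                                , (x , agree-sym s~t , ≤-trans (ρ-drop-agree s~t) ρ≤M , ρs<M)
      ... | no _     | yes ρt<M = t , t , (x , s~t , ρ≤M , ρt<M) , ε
                                , (x , (λ _ _ → ≡.refl) , ≤-trans (ρ-drop-agree s~t) ρ≤M , ρt<M)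
      ... | no ρs≮M  | no _     = s [ y ≔ c ] , t [ y ≔ c ]
                                , (y , agree-update s y c , ≤-trans (ρ-min (rep-drop reps ay≈0)) rr≤M
                                  , update-low reps ay≈0 0<Py∙r rr≤M)
                                , (x , update-agree y c s~t , <-≤-trans lower rr≤M) ◅ ε
                                , (y , agree-update t y c , ≤-trans (ρ-min (rep-drop reps′ ay≈0)) rr≤M
                                  , update-low reps′ ay≈0 0<Py∙r rr≤M)
        where
        M≤ρ : M ≤ ρ (drop x s)
        M≤ρ = ≤-trans (≮⇒≥ ρs≮M) (ρ-mono λ ra → _ , rep-undrop x ra)
        open Saddle (saddle x s (<-≤-trans 0<M M≤ρ))
        rr≤M : r ∙ r ≤ M
        rr≤M = ≤-respˡ ρ≈ ρ≤M
        reps′ : Rep z (chosen t) r a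
        reps′ = rep-agree₁ reps ax≈0 s~t
        lower : ρ (drop x (s [ y ≔ c ])) < r ∙ r
        lower = below reps ax≈0 ay≈0 y≢x 0<Py∙r (λ j _ j≢y → agree-update s y c j j≢y) (update-≡ s y c)

      -- The path is shadowed by low neighbours: those of consecutive vertices are linked, and those
      -- of a single vertex are connected.
      lower-path : ∀ {s t u} → LowNeighbour s u → Star (Edge (_≤ M)) s t → ρ (chosen t) < M → Star (Edge (_< M)) u t
      lower-path (y , s~u , ρ≤M , ρu<M) ε ρt<M =
        low-edge-connected (agree-sym s~u) (≤-trans (ρ-drop-agree s~u) ρ≤M) ρu<M ρt<M
      lower-path su (e ◅ path) ρt<M = let _ , _ , su′ , u′⇝v , s₁v = lowNeighbours-linked e in
        lowNeighbours-connected su su′ ◅◅ u′⇝v ◅◅ lower-path s₁v path ρt<M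

      mountain-pass : ∀ {s t} → ρ (chosen s) < M → ρ (chosen t) < M → Star (Edge (_≤ M)) s t → Star (Edge (_< M)) s t
      mountain-pass ρs<M ρt<M ε = ε
      mountain-pass ρs<M ρt<M path@((x , _ , ρ≤M) ◅ _) = lower-path (x , (λ _ _ → ≡.refl) , ρ≤M , ρs<M) path ρt<M

    -- Descent through the finitely many heights.

    Code : Set
    Code = Fin (k ℕ.^ m ℕ.* m)

    decode : Code → Choice × Fin m
    decode i = let s , x = remQuot m i in finToFun s , x

    value : Code → Carrier
    value i = let s , x = decode i in ρ (drop x s)

    -- Decoding recovers a choice only pointwise, so the two heights are compared through
    -- `ρ-drop-agree` in both directions.
    encode : ∀ s x → ∃ λ i → value i ≈ ρ (drop x s)
    encode s x = i , ≡.subst (λ p → ρ (drop (proj₂ p) (finToFun (proj₁ p))) ≈ ρ (drop x s))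
                             (≡.sym (Fin.remQuot-combine (funToFin s) x))
                             (antisym (ρ-drop-agree λ j _ → ≡.sym (same j)) (ρ-drop-agree λ j _ → same j))
      where
      i : Code
      i = combine (funToFin s) x
      same : ∀ j → finToFun (funToFin s) j ≡ s j
      same = Fin.finToFun-funToFin s

    -- The strict bound is replaced by an attained height, to which well-founded descent applies.
    -- The code `i` supplies one for the empty path.
    bounded-path : ∀ {M s t} i → value i < M → Star (Edge (_< M)) s t → ∃ λ j → value j < M × Star (Edge (_≤ value j)) s t
    bounded-path i i<M ε = i , i<M , ε
    bounded-path {M} {s} {t} i i<M (_◅_ {j = s′} (x , s~s′ , ρ<M) path) = extend (encode s x) (bounded-path i i<M path)
      where
      extend : (∃ λ l → value l ≈ ρ (drop x s)) → (∃ λ j → value j < M × Star (Edge (_≤ value j)) s′ t) →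
               ∃ λ j → value j < M × Star (Edge (_≤ value j)) s t
      extend (l , l≈ρ) (j , j<M , path′) with ≤-total (value j) (value l)
      ... | inj₁ j≤l = l , <-respˡ (sym l≈ρ) ρ<M
                     , (x , s~s′ , ≈⇒≤ (sym l≈ρ)) ◅ Star.map (λ (x , s~t , ρ≤j) → x , s~t , ≤-trans ρ≤j j≤l) path′
      ... | inj₂ l≤j = j , j<M , (x , s~s′ , ≤-respˡ l≈ρ l≤j) ◅ path′

    -- At a positive height `mountain-pass` makes the bound strict, and `bounded-path` then yields a
    -- smaller attained height.
    descend : ∀ {s t} i → Acc (λ i j → value i < value j) i → ρ (chosen s) ≤ 0# → ρ (chosen t) ≤ 0# →
              Star (Edge (_≤ value i)) s t → Star (Edge (_≤ 0#)) s t
    descend i (acc rec) ρs≤0 ρt≤0 path with value i ≤? 0#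
    ... | yes i≤0 = Star.map (λ (x , s~t , ρ≤i) → x , s~t , ≤-trans ρ≤i i≤0) path
    ... | no i≰0 = continue ρs≤0 ρt≤0 (mountain-pass 0<i (≤-<-trans ρs≤0 0<i) (≤-<-trans ρt≤0 0<i) path)
      where
      0<i : 0# < value i
      0<i = ≰⇒> i≰0
      continue : ∀ {s t} → ρ (chosen s) ≤ 0# → ρ (chosen t) ≤ 0# → Star (Edge (_< value i)) s t → Star (Edge (_≤ 0#)) s t
      continue ρs≤0 ρt≤0 ε = ε
      continue ρs≤0 ρt≤0 path@((x , _ , ρ<i) ◅ _) =
        let l , l≈ρ = encode _ x
            j , j<i , path′ = bounded-path l (<-respˡ (sym l≈ρ) ρ<i) path
        in descend j (rec j<i) ρs≤0 ρt≤0 path′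

    -- The zero combination leaves the residual `z`; the added `1#` makes the bound strict.
    ρ-bound : ∀ g → ρ g < z ∙ z + 1#
    ρ-bound g = ≤-<-trans (ρ-min (rep (λ _ → ≤-refl) λ e →
                            sym (trans (+-congʳ (sum-zero λ i → zeroˡ (g i e))) (+-identityˡ (z e)))))
                          (<-step 0<1 refl)

    x₀ : Fin m
    x₀ = fromℕ< (ℕ.≤-<-trans ℕ.z≤n D<m)

    all-connected : ∀ s t → Star (Edge (_< z ∙ z + 1#)) s t
    all-connected s t = go m ℕ.≤-refl s λ j m≤j → contradiction (Fin.toℕ<n j) (ℕ.≤⇒≯ m≤j)
      where
      go : ∀ n → n ℕ.≤ m → ∀ s → (∀ j → n ℕ.≤ toℕ j → s j ≡ t j) → Star (Edge (_< z ∙ z + 1#)) s t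
      -- Here `s` and `t` agree pointwise but need not be equal as functions; a step at an arbitrary
      -- index joins them.
      go ℕ.zero    _   s s~t = (x₀ , (λ j _ → s~t j ℕ.z≤n) , ρ-bound _) ◅ ε
      go (ℕ.suc n) n<m s s~t = (x , agree-update s x (t x) , ρ-bound _) ◅ go n (ℕ.<⇒≤ n<m) (s [ x ≔ t x ]) agree
        where
        x : Fin m
        x = fromℕ< n<m
        agree : ∀ j → n ℕ.≤ toℕ j → (s [ x ≔ t x ]) j ≡ t j
        agree j n≤j with j Fin.≟ x
        ... | yes ≡.refl = update-≡ s j (t j)
        ... | no j≢x = ≡.trans (updateAt-minimal j x s j≢x) (s~t j (ℕ.≤∧≢⇒< n≤j λ n≡j →
                j≢x (Fin.toℕ-injective (≡.trans (≡.sym n≡j) (≡.sym (Fin.toℕ-fromℕ< n<m))))))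

    good-connected : ∀ {s t} → ρ (chosen s) ≤ 0# → ρ (chosen t) ≤ 0# → Star (Edge (_≤ 0#)) s t
    good-connected {s} {t} ρs≤0 ρt≤0 =
      let i , _ = encode s x₀
          j , _ , path = bounded-path i (ρ-bound _) (all-connected s t)
      in descend j (value-wellFounded value j) ρs≤0 ρt≤0 path

    -- Bárány's descent: while the distance with `x₀` omitted is positive, moving the free index of
    -- a saddle strictly lowers it.
    good-exists : ∃ λ s → ∃ λ x → ρ (drop x s) ≤ 0#
    good-exists = let i , i≈ρ = encode s₀ x₀ in go s₀ i (value-wellFounded value i) i≈ρ
      where
      -- Applying `escape` to `z` itself supplies an initial value at every index.
      s₀ : Choice
      s₀ j = proj₁ (escape j 0<zz)
      go : ∀ s i → Acc (λ i j → value i < value j) i → value i ≈ ρ (drop x₀ s) → ∃ λ s → ∃ λ x → ρ (drop x s) ≤ 0#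
      go s i (acc rec) i≈ρ with ρ (drop x₀ s) ≤? 0#
      ... | yes ρ≤0 = s , x₀ , ρ≤0
      ... | no ρ≰0 = let j , j≈ρ = encode (s [ y ≔ c ]) x₀ in
          go (s [ y ≔ c ]) j (rec (<-respˡ (sym j≈ρ) (<-respʳ (trans (sym ρ≈) (sym i≈ρ)) lower))) j≈ρ
        where
        open Saddle (saddle x₀ s (≰⇒> ρ≰0))
        lower : ρ (drop x₀ (s [ y ≔ c ])) < r ∙ r
        lower = below reps ax≈0 ay≈0 y≢x 0<Py∙r (λ j _ j≢y → agree-update s y c j j≢y) (update-≡ s y c)

    ρ≤0⇒decomp : ∀ {s x} → ρ (drop x s) ≤ 0# →
                 ∃ λ a → (∀ j → 0# ≤ a j) × a x ≈ 0# × (∀ e → z e ≈ lin a (chosen s) e)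
    ρ≤0⇒decomp {s} {x} ρ≤0 =
      let r , _ , (a , ra) , ρ≈ = residual (drop x s)
          ra′ = rep-undrop x ra
          r≈0 = ∙-square-zero r (antisym (≤-respˡ ρ≈ ρ≤0) (∙-square-nonneg r))
      in zeroed x a , Rep.nonneg ra′ , reflexive (updateAt-updates x a)
         , λ e → trans (Rep.decomp ra′ e) (trans (+-congˡ (r≈0 e)) (+-identityʳ _))

    decomp⇒ρ≤0 : ∀ {s a} → (∀ j → 0# ≤ a j) → (∀ e → z e ≈ lin a (chosen s) e) → ρ (chosen s) ≤ 0#
    decomp⇒ρ≤0 0≤a eq = ≤-trans (ρ-min (rep {r = λ _ → 0#} 0≤a λ e → trans (eq e) (sym (+-identityʳ _))))
                                (≈⇒≤ (sum-zero {D} λ e → zeroˡ 0#))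

-- Ordered partitions as fibres of class assignments.

module FibrePartitions where

  open ≡ using (refl; sym; trans; cong; subst)

  private
    variable
      n r : ℕ

  x∉p-x : ∀ (p : Subset n) x → x ∉ p ∖ x
  x∉p-x (_ Vec.∷ p) (suc x) (Vec.there x∈p-x) = x∉p-x p x x∈p-x

  x∈p-y⇒x≢y : ∀ {p : Subset n} {x y} → x ∈ p ∖ y → x ≢ y
  x∈p-y⇒x≢y {p = p} {x} x∈p-x refl = x∉p-x p x x∈p-x

  ∈⋃⁺ : ∀ (Ys : Vec (Subset n) r) i {x} → x ∈ lookup Ys i → x ∈ ⋃ (toList Ys)
  ∈⋃⁺ (Y Vec.∷ Ys) zero    x∈Y  = Subset.x∈p∪q⁺ (inj₁ x∈Y)
  ∈⋃⁺ (Y Vec.∷ Ys) (suc i) x∈Yᵢ = Subset.x∈p∪q⁺ (inj₂ (∈⋃⁺ Ys i x∈Yᵢ))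

  ∈⋃⁻ : ∀ (Ys : Vec (Subset n) r) {x} → x ∈ ⋃ (toList Ys) → ∃ λ i → x ∈ lookup Ys i
  ∈⋃⁻ Vec.[]       x∈⊥ = contradiction x∈⊥ Subset.∉⊥
  ∈⋃⁻ (Y Vec.∷ Ys) x∈⋃ = [ (zero ,_) , (λ x∈⋃ → let i , x∈Yᵢ = ∈⋃⁻ Ys x∈⋃ in suc i , x∈Yᵢ) ]′
                           (Subset.x∈p∪q⁻ Y (⋃ (toList Ys)) x∈⋃)

  lookup-ext : ∀ {a} {A : Set a} {xs ys : Vec A r} → (∀ i → lookup xs i ≡ lookup ys i) → xs ≡ ys
  lookup-ext {xs = xs} {ys} eq = trans (sym (Vec.tabulate∘lookup xs)) (trans (Vec.tabulate-cong eq) (Vec.tabulate∘lookup ys))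

  partition : (Fin n → Fin r) → Vec (Subset n) r
  partition s = tabulate λ i → tabulate λ j → does (s j Fin.≟ i)

  lookup-partition : ∀ (s : Fin n → Fin r) i j → lookup (lookup (partition s) i) j ≡ does (s j Fin.≟ i)
  lookup-partition s i j = trans (cong (λ p → lookup p j) (Vec.lookup∘tabulate (λ i → tabulate λ j → does (s j Fin.≟ i)) i))
                                 (Vec.lookup∘tabulate (λ j → does (s j Fin.≟ i)) j)

  ∈-partition⁺ : ∀ (s : Fin n → Fin r) j → j ∈ lookup (partition s) (s j)
  ∈-partition⁺ s j = Vec.lookup⇒[]= j _ (trans (lookup-partition s (s j) j) (dec-true (s j Fin.≟ s j) refl))

  ∈-partition⁻ : ∀ (s : Fin n → Fin r) {i j} → j ∈ lookup (partition s) i → s j ≡ i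
  ∈-partition⁻ s {i} {j} j∈ with s j Fin.≟ i | trans (sym (lookup-partition s i j)) (Vec.[]=⇒lookup j∈)
  ... | yes sj≡i | _ = sj≡i

  -- Stated relative to `Y`, so that one assignment describes a partition both before and after the
  -- deletion of a point.
  record Fibres (s : Fin n → Fin r) (Y : Subset n) (Ys : Vec (Subset n) r) : Set where
    constructor fibres
    field
      sound    : ∀ {i j} → j ∈ lookup Ys i → s j ≡ i × j ∈ Y
      complete : ∀ {j} → j ∈ Y → j ∈ lookup Ys (s j)

  fibres-partition : (s : Fin n → Fin r) → Fibres s ⊤ (partition s)
  fibres-partition s = fibres (λ j∈ → ∈-partition⁻ s j∈ , Subset.∈⊤) (λ {j} _ → ∈-partition⁺ s j)

  fibres-delete : ∀ {s : Fin n → Fin r} {Y Ys} x → Fibres s Y Ys → Fibres s (Y ∖ x) (map (_∖ x) Ys)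
  fibres-delete {s = s} {Y} {Ys} x (fibres sound complete) = fibres sound′ complete′
    where
    sound′ : ∀ {i j} → j ∈ lookup (map (_∖ x) Ys) i → s j ≡ i × j ∈ Y ∖ x
    sound′ {i} {j} j∈ =
      let j∈Yᵢ-x = subst (j ∈_) (Vec.lookup-map i (_∖ x) Ys) j∈
          sj≡i , j∈Y = sound (Subset.p─q⊆p (lookup Ys i) ⁅ x ⁆ j∈Yᵢ-x)
      in sj≡i , Subset.x∈p∧x≢y⇒x∈p-y j∈Y (x∈p-y⇒x≢y {p = lookup Ys i} j∈Yᵢ-x)
    complete′ : ∀ {j} → j ∈ Y ∖ x → j ∈ lookup (map (_∖ x) Ys) (s j)
    complete′ {j} j∈ = subst (j ∈_) (sym (Vec.lookup-map (s j) (_∖ x) Ys))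
      (Subset.x∈p∧x≢y⇒x∈p-y (complete (Subset.p─q⊆p Y ⁅ x ⁆ j∈)) (x∈p-y⇒x≢y {p = Y} j∈))

  -- Agreement on `Y` alone suffices, so assignments that differ only at `x` give the same tuple
  -- once `x` is deleted.
  fibres-unique : ∀ {s t : Fin n → Fin r} {Y Ys Zs} → (∀ {j} → j ∈ Y → s j ≡ t j) → Fibres s Y Ys → Fibres t Y Zs → Ys ≡ Zs
  fibres-unique {Ys = Ys} {Zs} s~t (fibres sound complete) (fibres sound′ complete′) = lookup-ext λ i → Subset.⊆-antisym
    (λ {j} j∈ → let sj≡i , j∈Y = sound j∈ in subst (λ i → j ∈ lookup Zs i) (trans (sym (s~t j∈Y)) sj≡i) (complete′ j∈Y))
    (λ {j} j∈ → let tj≡i , j∈Y = sound′ j∈ in subst (λ i → j ∈ lookup Ys i) (trans (s~t j∈Y) tj≡i) (complete j∈Y))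

  fibres-disjoint : ∀ {s : Fin n → Fin r} {Y Ys} → Fibres s Y Ys → ∀ {i j} → i ≢ j → Empty (lookup Ys i ∩ lookup Ys j)
  fibres-disjoint {Ys = Ys} (fibres sound _) {i} {j} i≢j (x , x∈) =
    let x∈Yᵢ , x∈Yⱼ = Subset.x∈p∩q⁻ (lookup Ys i) (lookup Ys j) x∈
    in i≢j (trans (sym (proj₁ (sound x∈Yᵢ))) (proj₁ (sound x∈Yⱼ)))

  fibres-union : ∀ {s : Fin n → Fin r} {Y Ys} → Fibres s Y Ys → ⋃ (toList Ys) ≡ Y
  fibres-union {Ys = Ys} (fibres sound complete) = Subset.⊆-antisym
    (λ x∈ → proj₂ (sound (proj₂ (∈⋃⁻ Ys x∈)))) (λ x∈Y → ∈⋃⁺ Ys _ (complete x∈Y))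

  disjoint-union⇒fibres : ∀ {Ys : Vec (Subset n) r} → (∀ {i j} → i ≢ j → Empty (lookup Ys i ∩ lookup Ys j)) →
                          ⋃ (toList Ys) ≡ ⊤ → ∃ λ s → Fibres s ⊤ Ys
  disjoint-union⇒fibres {n} {r} {Ys} disjoint union = s , fibres (λ j∈ → unique j∈ , Subset.∈⊤) (λ {j} _ → proj₂ (class j))
    where
    class : ∀ j → ∃ λ i → j ∈ lookup Ys i
    class j = ∈⋃⁻ Ys (subst (j ∈_) (sym union) Subset.∈⊤)
    s : Fin n → Fin r
    s j = proj₁ (class j)
    unique : ∀ {i j} → j ∈ lookup Ys i → s j ≡ i
    unique {i} {j} j∈ with s j Fin.≟ i
    ... | yes sj≡i = sj≡i
    ... | no sj≢i  = contradiction (j , Subset.x∈p∩q⁺ (proj₂ (class j) , j∈)) (disjoint sj≢i)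

-- Sarkaria's lift and the translation to Tverberg partitions.

module SarkariaLift {ℓ ℓ₁ ℓ₂} (ℝ : CompleteOrderedField ℓ ℓ₁ ℓ₂) where

  open OrderedField ℝ
  open LinearAlgebra ℝ
  open Representations ℝ
  open ColourfulChoices ℝ
  open FibrePartitions
  open ≈-Reasoning

  δ-refl : ∀ {n} (i : Fin n) → δ i i ≈ 1#
  δ-refl i with i Fin.≟ i
  ... | yes _  = refl
  ... | no i≢i = contradiction ≡.refl i≢i

  δ-≢ : ∀ {n} {i j : Fin n} → i ≢ j → δ i j ≈ 0#
  δ-≢ {i = i} {j} i≢j with i Fin.≟ j
  ... | yes i≡j = contradiction i≡j i≢j
  ... | no _    = refl

  δ-nonneg : ∀ {n} (i j : Fin n) → 0# ≤ δ i j
  δ-nonneg i j with i Fin.≟ j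
  ... | yes _ = <⇒≤ 0<1
  ... | no _  = ≤-refl

  δ-sym : ∀ {n} (i j : Fin n) → δ i j ≈ δ j i
  δ-sym i j with i Fin.≟ j
  ... | yes ≡.refl = sym (δ-refl i)
  ... | no i≢j     = sym (δ-≢ (≡.≢-sym i≢j))

  -- Sarkaria's tensor trick: the vectors e₁, …, eᵣ, -(e₁ + ⋯ + eᵣ) have zero sum as their
  -- only linear dependency, so z lies in the cone of the tensors (1 , X j) ⊗ v (s j) with weights a
  -- iff all classes of s have the same a-weighted sum of the vectors (1 , X j).  The number of
  -- classes is suc r below.
  module Sarkaria {d n : ℕ} (X : Vector (Point ℝ d) n) (r : ℕ) where

    D : ℕ
    D = ℕ.suc (ℕ.suc d ℕ.* r)

    X̂ : Fin n → Vector Carrier (ℕ.suc d)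
    X̂ j = 1# ∷ X j

    -- The leading coordinate records total weight. The others are the tensor entries: `e` codes a
    -- pair `k , i`, and the difference of deltas is coordinate `i` of the class vector, class
    -- `zero` receiving the negative sum.
    P : Fin n → Fin (ℕ.suc r) → Vector Carrier D
    P j c zero    = 1#
    P j c (suc e) = let k , i = remQuot r e in X̂ j k * (δ (suc i) c - δ zero c)

    r# : Carrier
    r# = sum {ℕ.suc r} λ _ → 1#

    -- The leading entry counts the classes, so that each class receives weight exactly 1.
    z : Vector Carrier D
    z = r# ∷ λ _ → 0#

    0<r# : 0# < r#
    0<r# = <-≤-trans 0<1 (≤-step (sum-nonneg {r} λ _ → <⇒≤ 0<1) refl)

    0<zz : 0# < z ∙ z
    0<zz = <-≤-trans (*-pos 0<r# 0<r#) (≤-step (∙-square-nonneg {ℕ.suc d ℕ.* r} λ _ → 0#) refl)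

    difference : ∀ (f : Vector Carrier (ℕ.suc r)) i → sum (λ c → f c * (δ (suc i) c - δ zero c)) ≈ f (suc i) - f zero
    difference f i = begin
      sum (λ c → f c * (δ (suc i) c - δ zero c))
        ≈⟨ sum-cong {ℕ.suc r} (λ c → solve 3 (λ f x y → f :* (x :- y) := f :* x :+ :- (f :* y)) refl (f c) (δ (suc i) c) (δ zero c)) ⟩
      sum (λ c → f c * δ (suc i) c + - (f c * δ zero c))
        ≈⟨ trans (∑-distrib-+ (λ c → f c * δ (suc i) c) (λ c → - (f c * δ zero c))) (+-congˡ (sum-neg (λ c → f c * δ zero c))) ⟩
      sum (λ c → f c * δ (suc i) c) - sum (λ c → f c * δ zero c)
        ≈⟨ +-cong (sum-δ (suc i) f) (-‿cong (sum-δ zero f)) ⟩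
      f (suc i) - f zero
        ∎

    sum-P : ∀ j e → lin (λ _ → 1#) (P j) e ≈ z e
    sum-P j zero    = sum-cong {ℕ.suc r} λ _ → *-identityˡ 1#
    sum-P j (suc e) = let k , i = remQuot r e in begin
      sum (λ c → 1# * (X̂ j k * (δ (suc i) c - δ zero c)))
        ≈⟨ sum-cong {ℕ.suc r} (λ c → *-identityˡ (X̂ j k * (δ (suc i) c - δ zero c))) ⟩
      sum (λ c → X̂ j k * (δ (suc i) c - δ zero c))           ≈⟨ difference (λ _ → X̂ j k) i ⟩
      X̂ j k - X̂ j k                                         ≈⟨ -‿inverseʳ _ ⟩
      0#                                                     ∎

    -- For each `j` the vectors `P j c` add up to `z`, so if their inner products with `q` were all
    -- nonpositive, `z ∙ q` would be too.
    escape : ∀ j {q} → 0# < z ∙ q → ∃ λ c → 0# < P j c ∙ q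
    escape j {q} 0<zq with Fin.any? (λ c → 0# <? P j c ∙ q)
    ... | yes found = found
    ... | no none = contradiction (≤-respˡ sum≈zq (sum-nonpos λ c → ≮⇒≥ λ 0<Pq → none (c , 0<Pq))) (<⇒≱ 0<zq)
      where
      sum≈zq : sum (λ c → P j c ∙ q) ≈ z ∙ q
      sum≈zq = begin
        sum (λ c → P j c ∙ q)           ≈⟨ sum-cong {ℕ.suc r} (λ c → *-identityˡ (P j c ∙ q)) ⟨
        sum (λ c → 1# * P j c ∙ q)      ≈⟨ ∙-lin (λ _ → 1#) (P j) q ⟨
        lin (λ _ → 1#) (P j) ∙ q        ≈⟨ ∙-congʳ q (sum-P j) ⟩
        z ∙ q                           ∎

    module _ (s : Fin n → Fin (ℕ.suc r)) (a : Vector Carrier n) where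

      classWeight : Fin (ℕ.suc r) → Vector Carrier n
      classWeight c j = a j * δ c (s j)

      classSum : Fin (ℕ.suc r) → Vector Carrier (ℕ.suc d)
      classSum c k = sum λ j → classWeight c j * X̂ j k

      lin-zero : lin a (λ j → P j (s j)) zero ≈ sum a
      lin-zero = sum-cong {n} λ j → *-identityʳ (a j)

      lin-suc : ∀ e → let k , i = remQuot r e in lin a (λ j → P j (s j)) (suc e) ≈ classSum (suc i) k - classSum zero k
      lin-suc e = let k , i = remQuot r e in begin
        sum (λ j → a j * (X̂ j k * (δ (suc i) (s j) - δ zero (s j))))
          ≈⟨ sum-cong {n} (λ j → solve 4 (λ a x p q → a :* (x :* (p :- q)) := a :* p :* x :+ :- (a :* q :* x)) refl
                                    (a j) (X̂ j k) (δ (suc i) (s j)) (δ zero (s j))) ⟩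
        sum (λ j → classWeight (suc i) j * X̂ j k + - (classWeight zero j * X̂ j k))
          ≈⟨ trans (∑-distrib-+ {n} _ _) (+-congˡ (sum-neg {n} _)) ⟩
        classSum (suc i) k - classSum zero k
          ∎

      sum-classWeight : ∀ c → classSum c zero ≈ sum (classWeight c)
      sum-classWeight c = sum-cong {n} λ j → *-identityʳ _

      total : sum (λ c → sum (classWeight c)) ≈ sum a
      total = begin
        sum (λ c → sum (classWeight c))           ≈⟨ ∑-comm {ℕ.suc r} {n} classWeight ⟩
        sum (λ j → sum (λ c → a j * δ c (s j)))
          ≈⟨ sum-cong {n} (λ j → sum-cong {ℕ.suc r} λ c → *-congˡ {a j} (δ-sym c (s j))) ⟩
        sum (λ j → sum (λ c → a j * δ (s j) c))   ≈⟨ sum-cong {n} (λ j → sum-δ (s j) (λ _ → a j)) ⟩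
        sum a                                     ∎

    module _ {s : Fin n → Fin (ℕ.suc r)} {a : Vector Carrier n}
             (0≤a : ∀ j → 0# ≤ a j) (eq : ∀ e → z e ≈ lin a (λ j → P j (s j)) e) where

      classSum-const : ∀ c k → classSum s a c k ≈ classSum s a zero k
      classSum-const zero    k = refl
      classSum-const (suc i) k = x-y≈0⇒x≈y (sym (≡.subst
        (λ (k , i) → 0# ≈ classSum s a (suc i) k - classSum s a zero k) (Fin.remQuot-combine k i)
        (trans (eq (suc (combine k i))) (lin-suc s a (combine k i)))))

      -- The classes have equal weights, and the leading coordinate makes these add up to the number
      -- of classes.
      classSum≈1 : ∀ c → classSum s a c zero ≈ 1#
      classSum≈1 c = trans (classSum-const c zero) (x-y≈0⇒x≈y (*-zeroˡ-pos 0<r# (begin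
        (θ - 1#) * r#      ≈⟨ solve 2 (λ θ r → (θ :- con (1 , 0)) :* r := θ :* r :- r) refl θ r# ⟩
        θ * r# - r#        ≈⟨ +-congʳ θr≈r ⟩
        r# - r#            ≈⟨ -‿inverseʳ r# ⟩
        0#                 ∎)))
        where
        θ : Carrier
        θ = classSum s a zero zero
        θr≈r : θ * r# ≈ r#
        θr≈r = begin
          θ * r#                                 ≈⟨ *-distribˡ-sum {ℕ.suc r} θ (λ _ → 1#) ⟩
          sum {ℕ.suc r} (λ c → θ * 1#)
            ≈⟨ sum-cong {ℕ.suc r} (λ c → trans (*-identityʳ θ) (trans (sym (classSum-const c zero)) (sum-classWeight s a c))) ⟩
          sum (λ c → sum (classWeight s a c))    ≈⟨ total s a ⟩
          sum a                                  ≈⟨ lin-zero s a ⟨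
          lin a (λ j → P j (s j)) zero           ≈⟨ eq zero ⟨
          r#                                     ∎

      decomp⇒tverberg : ∀ {Y Ys} → Fibres s Y Ys → (∀ j → j ∉ Y → a j ≈ 0#) → IsTverbergPartition ℝ X Y Ys
      decomp⇒tverberg {Y} {Ys} F outside = record
        { disjoint     = fibres-disjoint F
        ; union        = fibres-union F
        -- The common point is the weighted sum of class `zero`; by `classSum-const` the other
        -- classes have the same sum.
        ; intersecting = (λ k → classSum s a zero (suc k)) , λ c → record
            { weight      = classWeight s a c
            ; nonneg      = λ j → *-nonneg (0≤a j) (δ-nonneg c (s j))
            ; supported   = supported c
            ; sum≈1       = trans (sym (sum-classWeight s a c)) (classSum≈1 c)
            ; combination = λ k → classSum-const c (suc k)
            }
        }
        where
        supported : ∀ c j → j ∉ lookup Ys c → classWeight s a c j ≈ 0#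
        supported c j j∉Yc with c Fin.≟ s j
        ... | no _ = zeroʳ (a j)
        ... | yes ≡.refl = trans (*-identityʳ (a j)) (outside j (j∉Yc ∘ Fibres.complete F))

    -- Each index takes its weight from the convex combination of its own class. All class sums then
    -- equal the lifted common point `p̂`, and their differences vanish.
    tverberg⇒decomp : ∀ {s Ys} → Fibres s ⊤ Ys → IsTverbergPartition ℝ X ⊤ Ys →
                      ∃ λ a → (∀ j → 0# ≤ a j) × (∀ e → z e ≈ lin a (λ j → P j (s j)) e)
    tverberg⇒decomp {s} {Ys} (fibres sound _) tverberg = a , (λ j → nonneg (s j) j) , eq
      where
      open IsTverbergPartition tverberg
      open module Conv c = _∈conv_ (proj₂ intersecting c)

      a : Vector Carrier n
      a j = weight (s j) j

      classWeight≈ : ∀ c j → classWeight s a c j ≈ weight c j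
      classWeight≈ c j with c Fin.≟ s j
      ... | yes ≡.refl = *-identityʳ _
      ... | no c≢sj    = trans (zeroʳ _) (sym (supported c j λ j∈Yc → c≢sj (≡.sym (proj₁ (sound j∈Yc)))))

      p̂ : Vector Carrier (ℕ.suc d)
      p̂ = 1# ∷ proj₁ intersecting

      classSum≈ : ∀ c k → classSum s a c k ≈ p̂ k
      classSum≈ c zero    = trans (sum-classWeight s a c) (trans (sum-cong {n} (classWeight≈ c)) (sum≈1 c))
      classSum≈ c (suc k) = trans (sum-cong {n} λ j → *-congʳ (classWeight≈ c j)) (combination c k)

      eq : ∀ e → z e ≈ lin a (λ j → P j (s j)) e
      eq zero = begin
        sum {ℕ.suc r} (λ _ → 1#)
          ≈⟨ sum-cong {ℕ.suc r} (λ c → trans (sym (sum-classWeight s a c)) (classSum≈ c zero)) ⟨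
        sum (λ c → sum (classWeight s a c))    ≈⟨ total s a ⟩
        sum a                                  ≈⟨ lin-zero s a ⟨
        lin a (λ j → P j (s j)) zero           ∎
      eq (suc e) = let k , i = remQuot r e in sym (begin
        lin a (λ j → P j (s j)) (suc e)             ≈⟨ lin-suc s a e ⟩
        classSum s a (suc i) k - classSum s a zero k ≈⟨ +-cong (classSum≈ (suc i) k) (-‿cong (classSum≈ zero k)) ⟩
        p̂ k - p̂ k                                   ≈⟨ -‿inverseʳ _ ⟩
        0#                                          ∎)

    module _ (D<n : D ℕ.< n) where

      open Colourful D<n z 0<zz P escape
      open Distance {D} {n} z using (ρ)

      drop≤0⇒deleted : ∀ {s x} → ρ (drop x s) ≤ 0# → IsTverbergPartition ℝ X (⊤ ∖ x) (delete ℝ X x (partition s))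
      drop≤0⇒deleted {s} {x} ρ≤0 = let a , 0≤a , ax≈0 , eq = ρ≤0⇒decomp {s} ρ≤0 in
        decomp⇒tverberg 0≤a eq (fibres-delete x (fibres-partition s)) (outside a ax≈0)
        where
        outside : ∀ a → a x ≈ 0# → ∀ j → j ∉ ⊤ ∖ x → a j ≈ 0#
        outside a ax≈0 j j∉ with j Fin.≟ x
        ... | yes ≡.refl = ax≈0
        ... | no j≢x     = contradiction (Subset.x∈p∧x≢y⇒x∈p-y Subset.∈⊤ j≢x) j∉

      drop≤0⇒vertex : ∀ {s x} → ρ (drop x s) ≤ 0# → IsTverbergPartition ℝ X ⊤ (partition s)
      drop≤0⇒vertex {s} ρ≤0 = let _ , 0≤a , _ , eq = ρ≤0⇒decomp {s} ρ≤0 in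
        decomp⇒tverberg 0≤a eq (fibres-partition s) λ j j∉⊤ → contradiction Subset.∈⊤ j∉⊤

      -- Adjacency requires distinct partitions, so a step that leaves the partition unchanged
      -- becomes the empty path.
      edge⇒path : ∀ {s t} → Edge (_≤ 0#) s t → Star (RGAdjacent ℝ X) (partition s) (partition t)
      edge⇒path {s} {t} (x , s~t , ρ≤0) with Vec.≡-dec (Vec.≡-dec Bool._≟_) (partition s) (partition t)
      ... | yes same  = ≡.subst (Star (RGAdjacent ℝ X) (partition s)) same ε
      ... | no differ = record
          { vertexˡ  = drop≤0⇒vertex ρ≤0
          ; vertexʳ  = drop≤0⇒vertex ρ≤0′
          ; x        = x
          ; differ   = differ
          ; onlyAt   = fibres-unique (λ {j} j∈ → s~t j (x∈p-y⇒x≢y {p = ⊤} j∈))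
                         (fibres-delete x (fibres-partition s)) (fibres-delete x (fibres-partition t))
          ; deletedˡ = drop≤0⇒deleted ρ≤0
          ; deletedʳ = drop≤0⇒deleted ρ≤0′
          } ◅ ε
        where
        ρ≤0′ : ρ (drop x t) ≤ 0#
        ρ≤0′ = ≤-trans (ρ-drop-agree s~t) ρ≤0

      vertex⇒choice : ∀ {Ys} → IsTverbergPartition ℝ X ⊤ Ys → ∃ λ s → ρ (chosen s) ≤ 0# × Ys ≡ partition s
      vertex⇒choice tverberg =
        let open IsTverbergPartition tverberg
            s , F = disjoint-union⇒fibres disjoint union
            _ , 0≤a , eq = tverberg⇒decomp F tverberg
        in s , decomp⇒ρ≤0 {s} 0≤a eq , fibres-unique (λ _ → ≡.refl) F (fibres-partition s)

      connected : Connected (RGTv ℝ X (ℕ.suc r))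
      connected = (let s , _ , ρ≤0 = good-exists in partition s , drop≤0⇒vertex ρ≤0)
                , λ v w → path (vertex⇒choice v) (vertex⇒choice w)
        where
        path : ∀ {Ys Zs} → (∃ λ s → ρ (chosen s) ≤ 0# × Ys ≡ partition s) → (∃ λ t → ρ (chosen t) ≤ 0# × Zs ≡ partition t) →
               Star (RGAdjacent ℝ X) Ys Zs
        path (s , ρs≤0 , ≡.refl) (t , ρt≤0 , ≡.refl) = kleisliStar partition edge⇒path (good-connected ρs≤0 ρt≤0)

open import Data.Nat.Base using (ℕ; suc; _+_; _*_; _∸_; _≥_)

theorem1p2 : ∀ {c ℓ₁ ℓ₂} (ℝ : CompleteOrderedField c ℓ₁ ℓ₂) (d n r : ℕ)
    (X : Vector (Point ℝ d) n) → Distinct ℝ X →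
    r ≥ 1 →
    n ≥ suc d * (r ∸ 1) + 2 →
    Connected (RGTv ℝ X r)
theorem1p2 ℝ d n (suc r) X _ _ n≥ =
  -- Here `r` is one less than the number of classes, and `D<n` unfolds to `2 + suc d * r ≤ n`, the
  -- assumed bound up to commutativity.
  SarkariaLift.Sarkaria.connected ℝ X r (ℕ.≤-trans (ℕ.≤-reflexive (ℕ.+-comm 2 (suc d * r))) n≥)
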